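{- Let $m,N\geq0$, $g\in\Lambda_m$ and $f\in\mathrm{QSym}_N$ (so that $gf\in\mathrm{QSym}_{N+m}$, since $\Lambda_m\subseteq\mathrm{QSym}_m$). Then $$\Phi_{N+m}(gf)=\rho(g)\,\Phi_N(f).$$ In particular, for every partition $\lambda$, $\Phi_{N+|\lambda|}(s_\lambda f)=\mathcal G_\lambda\,\Phi_N(f)$. Moreover, for all partitions $\lambda$ and $\mu$, $$\mathcal G_\lambda\mathcal G_\mu=\sum_{\nu\vdash|\lambda|+|\mu|}c_{\lambda\mu}^{\nu}\,\mathcal G_\nu .$$
   Context: Work over $\mathbb Q$. $\mathrm{QSym}_N$ is the degree-$N$ homogeneous component of the ring of quasisymmetric functions in commuting variables $z_1,z_2,\ldots$. For $N\geq1$ and $S\subseteq[N-1]$, $F_{N,S}=\sum z_{i_1}\cdots z_{i_N}$ over $1\leq i_1\leq\cdots\leq i_N$ with $i_j<i_{j+1}$ for all $j\in S$; $F_{0,\varnothing}=1$. These form a basis of $\mathrm{QSym}_N$. The linear map $\Phi_N:\mathrm{QSym}_N\to\mathbb Q[x,y]$ is defined by $\Phi_N(F_{N,S})=x^{|S|+1}y^{N-|S|}$, with $\Phi_0(1)=x$. With $D=\partial_x+\partial_y$, put $\mathcal G_0=\mathrm{id}$, $\mathcal G_r=y^r\sum_{j=1}^{r}\binom{r-1}{j-1}\frac{x^j}{j!}D^j$ for $r\geq1$ (operators on $\mathbb Q[x,y]$), and $\mathcal G_m=0$ for $m<0$. The operators $\mathcal G_r$ commute pairwise. $\Lambda=\mathbb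 Q[h_1,h_2,\ldots]$ is the ring of symmetric functions over $\mathbb Q$, freely generated by the complete homogeneous functions $h_r$, and $\Lambda_m$ is its degree-$m$ component. $\rho:\Lambda\to\mathrm{End}_{\mathbb Q}(\mathbb Q[x,y])$ is the unique unital algebra homomorphism with $\rho(h_r)=\mathcal G_r$ (the product in the endomorphism algebra is composition). For a partition $\lambda=(\lambda_1,\ldots,\lambda_\ell)$ of size $|\lambda|$, $s_\lambda$ is the Schur function and $\mathcal G_\lambda=\rho(s_\lambda)=\det(\mathcal G_{\lambda_i-i+j})_{1\leq i,j\leq\ell}$. The Littlewood–Richardson coefficients $c_{\lambda\mu}^\nu$ are defined by $s_\lambda s_\mu=\sum_\nu c_{\lambda\mu}^\nu s_\nu$. -}

module Defs where

open import Level using (0ℓ)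
open import Algebra.Bundles using (RawRing; Ring; CommutativeRing)
open import Algebra.Module.Bundles using (LeftModule)
open import Algebra.Module.Morphism.Structures using (IsLeftModuleHomomorphism)
import Algebra.Module.Properties.LeftModule as LeftModuleProperties
import Algebra.Module.Construct.TensorUnit as TensorUnit
import Algebra.Definitions.RawSemiring as RawSemiringOps
import Algebra.Properties.CommutativeSemigroup as CommutativeSemigroupProperties
import Algebra.Properties.CommutativeMonoid.Sum
open import Data.Bool using (true; false; if_then_else_)
open import Data.Fin as Fin using (Fin; zero; suc; toℕ; punchIn)
import Data.Fin.Properties as Fin
open import Data.Fin.Subset using (Subset; inside; outside; ∣_∣)
open import Data.Integer as ℤ using (ℤ; +_; -[1+_])
import Data.Integer.Properties as ℤ
import Data.List.Properties as List
open import Data.List as List using (List; []; _∷_; _++_; map; filter; foldr; length; allFin; cartesianProductWith)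
open import Data.Nat.ListAction using (sum)
open import Data.Nat as ℕ using (ℕ; zero; suc; _∸_; _!)
open import Data.Nat.Combinatorics using (_C_)
import Data.Nat.Properties as ℕ
open import Data.Product using (_×_; _,_; proj₁; proj₂; ∃-syntax)
open import Data.Rational as ℚ using (ℚ; 0ℚ; 1ℚ)
import Data.Rational.Properties as ℚ
open import Data.Unit using (⊤; tt)
open import Data.Empty using (⊥; ⊥-elim)
open import Data.Vec as Vec using (Vec; []; _∷_)
import Data.Vec.Properties as Vec
import Data.Vec.Relation.Unary.All as VecAll
open import Data.List.Membership.Propositional using (_∈_)
import Data.List.Membership.Propositional.Properties as ∈
open import Data.List.Relation.Unary.All as All using (All; []; _∷_)
open import Data.List.Relation.Unary.Any using (here; there)
open import Data.List.Relation.Unary.AllPairs using ([]; _∷_)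
open import Data.List.Relation.Unary.Linked using (Linked; linked?)
open import Data.List.Relation.Unary.Unique.Propositional using (Unique)
import Data.List.Relation.Unary.Unique.Propositional.Properties as Unique
open import Relation.Binary.Definitions using (tri<; tri≈; tri>)
open import Function using (_∘_; id; _⇔_; mk⇔)
open import Relation.Binary using (Rel)
open import Relation.Binary.PropositionalEquality using (_≡_; _≢_; refl; cong; cong₂; sym; trans; subst)
open import Relation.Nullary using (Dec; yes; no; ¬_; ¬?; does)
open import Relation.Nullary.Decidable using (dec-true; dec-false; _×-dec_; map′)

ℚ-ring : Ring 0ℓ 0ℓ
ℚ-ring = ℚ.+-*-ring

-- ℚ[X], the polynomials with variables indexed by X, as the free commutative
-- ℚ-algebra on X: expressions modulo the congruence generated by the laws of
-- a commutative ℚ-algebra.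

data Poly (X : Set) : Set where
  con     : ℚ → Poly X
  var     : X → Poly X
  _⊕_ _⊗_ : Poly X → Poly X → Poly X

infixl 6 _⊕_
infixl 7 _⊗_
infix  4 _≋_

data _≋_ {X : Set} : Rel (Poly X) 0ℓ where
  ≋-refl       : ∀ {p} → p ≋ p
  ≋-sym        : ∀ {p q} → p ≋ q → q ≋ p
  ≋-trans      : ∀ {p q r} → p ≋ q → q ≋ r → p ≋ r
  ⊕-cong       : ∀ {p p′ q q′} → p ≋ p′ → q ≋ q′ → p ⊕ q ≋ p′ ⊕ q′
  ⊗-cong       : ∀ {p p′ q q′} → p ≋ p′ → q ≋ q′ → p ⊗ q ≋ p′ ⊗ q′
  ⊕-assoc      : ∀ p q r → (p ⊕ q) ⊕ r ≋ p ⊕ (q ⊕ r)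
  ⊕-comm       : ∀ p q → p ⊕ q ≋ q ⊕ p
  ⊕-identityˡ  : ∀ p → con 0ℚ ⊕ p ≋ p
  ⊗-assoc      : ∀ p q r → (p ⊗ q) ⊗ r ≋ p ⊗ (q ⊗ r)
  ⊗-comm       : ∀ p q → p ⊗ q ≋ q ⊗ p
  ⊗-identityˡ  : ∀ p → con 1ℚ ⊗ p ≋ p
  ⊗-zeroˡ      : ∀ p → con 0ℚ ⊗ p ≋ con 0ℚ
  ⊗-distribˡ-⊕ : ∀ p q r → p ⊗ (q ⊕ r) ≋ (p ⊗ q) ⊕ (p ⊗ r)
  con-⊕        : ∀ a b → con (a ℚ.+ b) ≋ con a ⊕ con b
  con-⊗        : ∀ a b → con (a ℚ.* b) ≋ con a ⊗ con b

module _ (X : Set) where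

  private
    neg : Poly X → Poly X
    neg p = con (ℚ.- 1ℚ) ⊗ p

    ≋-reflexive : {p q : Poly X} → p ≡ q → p ≋ q
    ≋-reflexive refl = ≋-refl

    distribʳ : (p q r : Poly X) → (q ⊕ r) ⊗ p ≋ (q ⊗ p) ⊕ (r ⊗ p)
    distribʳ p q r = ≋-trans (⊗-comm _ _)
      (≋-trans (⊗-distribˡ-⊕ p q r) (⊕-cong (⊗-comm _ _) (⊗-comm _ _)))

    inverseˡ : (p : Poly X) → neg p ⊕ p ≋ con 0ℚ
    inverseˡ p = ≋-trans (⊕-cong ≋-refl (≋-sym (⊗-identityˡ p)))
      (≋-trans (≋-sym (distribʳ p _ _))
      (≋-trans (⊗-cong (≋-sym (con-⊕ (ℚ.- 1ℚ) 1ℚ)) ≋-refl) (⊗-zeroˡ p)))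

  polyRing : CommutativeRing 0ℓ 0ℓ
  polyRing = record
    { Carrier = Poly X
    ; _≈_ = _≋_
    ; _+_ = _⊕_
    ; _*_ = _⊗_
    ; -_ = neg
    ; 0# = con 0ℚ
    ; 1# = con 1ℚ
    ; isCommutativeRing = record
      { isRing = record
        { +-isAbelianGroup = record
          { isGroup = record
            { isMonoid = record
              { isSemigroup = record
                { isMagma = record
                  { isEquivalence = record { refl = ≋-refl ; sym = ≋-sym ; trans = ≋-trans }
                  ; ∙-cong = ⊕-cong }
                ; assoc = ⊕-assoc }
              ; identity = ⊕-identityˡ , λ p → ≋-trans (⊕-comm _ _) (⊕-identityˡ p) }
            ; inverse = inverseˡ , λ p → ≋-trans (⊕-comm _ _) (inverseˡ p)
            ; ⁻¹-cong = ⊗-cong ≋-refl }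
          ; comm = ⊕-comm }
        ; *-cong = ⊗-cong
        ; *-assoc = ⊗-assoc
        ; *-identity = ⊗-identityˡ , λ p → ≋-trans (⊗-comm _ _) (⊗-identityˡ p)
        ; distrib = ⊗-distribˡ-⊕ , distribʳ }
      ; *-comm = ⊗-comm } }

  polyModule : LeftModule ℚ-ring 0ℓ 0ℓ
  polyModule = record
    { Carrierᴹ = Poly X
    ; _≈ᴹ_ = _≋_
    ; _+ᴹ_ = _⊕_
    ; _*ₗ_ = λ a p → con a ⊗ p
    ; 0ᴹ = con 0ℚ
    ; -ᴹ_ = neg
    ; isLeftModule = record
      { isLeftSemimodule = record
        { +ᴹ-isCommutativeMonoid = CommutativeRing.+-isCommutativeMonoid polyRing
        ; isPreleftSemimodule = record
          { *ₗ-cong = λ eq → ⊗-cong (≋-reflexive (cong con eq))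
          ; *ₗ-zeroˡ = ⊗-zeroˡ
          ; *ₗ-distribʳ = λ p a b → ≋-trans (⊗-cong (con-⊕ a b) ≋-refl) (distribʳ p _ _)
          ; *ₗ-identityˡ = ⊗-identityˡ
          ; *ₗ-assoc = λ a b p → ≋-trans (⊗-cong (con-⊗ a b) ≋-refl) (⊗-assoc _ _ _)
          ; *ₗ-zeroʳ = λ a → ≋-trans (⊗-comm _ _) (⊗-zeroˡ _)
          ; *ₗ-distribˡ = λ a p q → ⊗-distribˡ-⊕ _ p q } }
      ; -ᴹ‿cong = ⊗-cong ≋-refl
      ; -ᴹ‿inverse = CommutativeRing.-‿inverse polyRing } }

-- The ℚ-linear derivation sending each variable i to δ i.

module _ {X : Set} (δ : X → Poly X) where

  derive : Poly X → Poly X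
  derive (con a) = con 0ℚ
  derive (var i) = δ i
  derive (p ⊕ q) = derive p ⊕ derive q
  derive (p ⊗ q) = (derive p ⊗ q) ⊕ (p ⊗ derive q)

  private open module R = CommutativeRing (polyRing X) using (setoid; +-congˡ; distribʳ; +-commutativeSemigroup)
  private open module S = CommutativeSemigroupProperties +-commutativeSemigroup using (interchange)
  open import Relation.Binary.Reasoning.Setoid setoid

  derive-cong : ∀ {p q} → p ≋ q → derive p ≋ derive q
  derive-cong ≋-refl = ≋-refl
  derive-cong (≋-sym e) = ≋-sym (derive-cong e)
  derive-cong (≋-trans e e′) = ≋-trans (derive-cong e) (derive-cong e′)
  derive-cong (⊕-cong e e′) = ⊕-cong (derive-cong e) (derive-cong e′)
  derive-cong (⊗-cong e e′) = ⊕-cong (⊗-cong (derive-cong e) e′) (⊗-cong e (derive-cong e′))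
  derive-cong (⊕-assoc p q r) = ⊕-assoc _ _ _
  derive-cong (⊕-comm p q) = ⊕-comm _ _
  derive-cong (⊕-identityˡ p) = ⊕-identityˡ _
  derive-cong (⊗-assoc p q r) = begin
    (derive p ⊗ q ⊕ p ⊗ derive q) ⊗ r ⊕ p ⊗ q ⊗ derive r
      ≈⟨ ⊕-cong (distribʳ r _ _) (⊗-assoc p q _) ⟩
    (derive p ⊗ q ⊗ r ⊕ p ⊗ derive q ⊗ r) ⊕ p ⊗ (q ⊗ derive r)
      ≈⟨ ⊕-assoc _ _ _ ⟩
    derive p ⊗ q ⊗ r ⊕ (p ⊗ derive q ⊗ r ⊕ p ⊗ (q ⊗ derive r))
      ≈⟨ ⊕-cong (⊗-assoc _ q r) (⊕-cong (⊗-assoc p _ r) ≋-refl) ⟩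
    derive p ⊗ (q ⊗ r) ⊕ (p ⊗ (derive q ⊗ r) ⊕ p ⊗ (q ⊗ derive r))
      ≈⟨ +-congˡ (⊗-distribˡ-⊕ p _ _) ⟨
    derive p ⊗ (q ⊗ r) ⊕ p ⊗ (derive q ⊗ r ⊕ q ⊗ derive r) ∎
  derive-cong (⊗-comm p q) = ≋-trans (⊕-comm _ _) (⊕-cong (⊗-comm _ _) (⊗-comm _ _))
  derive-cong (⊗-identityˡ p) =
    ≋-trans (⊕-cong (⊗-zeroˡ _) (⊗-identityˡ _)) (⊕-identityˡ _)
  derive-cong (⊗-zeroˡ p) =
    ≋-trans (⊕-cong (⊗-zeroˡ _) (⊗-zeroˡ _)) (⊕-identityˡ _)
  derive-cong (⊗-distribˡ-⊕ p q r) = begin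
    derive p ⊗ (q ⊕ r) ⊕ p ⊗ (derive q ⊕ derive r)
      ≈⟨ ⊕-cong (⊗-distribˡ-⊕ _ q r) (⊗-distribˡ-⊕ p _ _) ⟩
    (derive p ⊗ q ⊕ derive p ⊗ r) ⊕ (p ⊗ derive q ⊕ p ⊗ derive r)
      ≈⟨ interchange _ _ _ _ ⟩
    (derive p ⊗ q ⊕ p ⊗ derive q) ⊕ (derive p ⊗ r ⊕ p ⊗ derive r) ∎
  derive-cong (con-⊕ a b) = ≋-sym (⊕-identityˡ _)
  derive-cong (con-⊗ a b) = ≋-sym
    (≋-trans (⊕-cong (⊗-zeroˡ _) (≋-trans (⊗-comm _ _) (⊗-zeroˡ _))) (⊕-identityˡ _))

record LinearMap (M N : LeftModule ℚ-ring 0ℓ 0ℓ) : Set where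
  no-eta-equality
  private
    module M = LeftModule M
    module N = LeftModule N
  field
    ⟦_⟧      : M.Carrierᴹ → N.Carrierᴹ
    isLinear : IsLeftModuleHomomorphism M.rawLeftModule N.rawLeftModule ⟦_⟧
  open IsLeftModuleHomomorphism isLinear public

open LinearMap

module _ (M N : LeftModule ℚ-ring 0ℓ 0ℓ) where
  private
    module M = LeftModule M
    module N = LeftModule N

  linear : {f : M.Carrierᴹ → N.Carrierᴹ} →
           (∀ {u v} → u M.≈ᴹ v → f u N.≈ᴹ f v) →
           (∀ u v → f (u M.+ᴹ v) N.≈ᴹ f u N.+ᴹ f v) →
           (∀ a u → f (a M.*ₗ u) N.≈ᴹ a N.*ₗ f u) →
           IsLeftModuleHomomorphism M.rawLeftModule N.rawLeftModule f
  linear {f} f-cong f-+ f-* = record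
    { +ᴹ-isGroupHomomorphism = record
      { isMonoidHomomorphism = record
        { isMagmaHomomorphism = record
          { isRelHomomorphism = record { cong = f-cong }
          ; homo = f-+ }
        ; ε-homo = f-0 }
      ; ⁻¹-homo = λ u → LeftModuleProperties.inverseˡ-uniqueᴹ N _ _
          (N.≈ᴹ-trans (N.≈ᴹ-sym (f-+ _ _)) (N.≈ᴹ-trans (f-cong (M.-ᴹ‿inverseˡ u)) f-0)) }
    ; *ₗ-homo = f-* }
    where
    f-0 : f M.0ᴹ N.≈ᴹ N.0ᴹ
    f-0 = N.≈ᴹ-trans (f-cong (M.≈ᴹ-sym (M.*ₗ-zeroˡ M.0ᴹ)))
            (N.≈ᴹ-trans (f-* 0ℚ M.0ᴹ) (N.*ₗ-zeroˡ _))

module _ {M : LeftModule ℚ-ring 0ℓ 0ℓ} where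
  open LeftModule M

  +ᴹ-interchange : ∀ a b c d → (a +ᴹ b) +ᴹ (c +ᴹ d) ≈ᴹ (a +ᴹ c) +ᴹ (b +ᴹ d)
  +ᴹ-interchange = CommutativeSemigroupProperties.interchange
    (record { isCommutativeSemigroup = record { isSemigroup = +ᴹ-isSemigroup ; comm = +ᴹ-comm } })

  infixl 6 _+ᴱ_
  infixl 7 _∘ᴱ_

  scale : ℚ → LinearMap M M
  ⟦ scale a ⟧ u = a *ₗ u
  isLinear (scale a) = linear M M *ₗ-congˡ (*ₗ-distribˡ a) λ b u →
    ≈ᴹ-trans (≈ᴹ-sym (*ₗ-assoc a b u))
      (≈ᴹ-trans (*ₗ-congʳ (ℚ.*-comm a b)) (*ₗ-assoc b a u))

  _+ᴱ_ : LinearMap M M → LinearMap M M → LinearMap M M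
  ⟦ F +ᴱ G ⟧ u = ⟦ F ⟧ u +ᴹ ⟦ G ⟧ u
  isLinear (F +ᴱ G) = linear M M
    (λ eq → +ᴹ-cong (⟦⟧-cong F eq) (⟦⟧-cong G eq))
    (λ u v → ≈ᴹ-trans (+ᴹ-cong (+ᴹ-homo F u v) (+ᴹ-homo G u v)) (+ᴹ-interchange _ _ _ _))
    (λ a u → ≈ᴹ-trans (+ᴹ-cong (*ₗ-homo F a u) (*ₗ-homo G a u)) (≈ᴹ-sym (*ₗ-distribˡ a _ _)))

  _∘ᴱ_ : LinearMap M M → LinearMap M M → LinearMap M M
  ⟦ F ∘ᴱ G ⟧ u = ⟦ F ⟧ (⟦ G ⟧ u)
  isLinear (F ∘ᴱ G) = linear M M
    (⟦⟧-cong F ∘ ⟦⟧-cong G)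
    (λ u v → ≈ᴹ-trans (⟦⟧-cong F (+ᴹ-homo G u v)) (+ᴹ-homo F _ _))
    (λ a u → ≈ᴹ-trans (⟦⟧-cong F (*ₗ-homo G a u)) (*ₗ-homo F _ _))

  0ᴱ 1ᴱ : LinearMap M M
  ⟦ 0ᴱ ⟧ u = 0ᴹ
  isLinear 0ᴱ = linear M M (λ _ → ≈ᴹ-refl)
    (λ _ _ → ≈ᴹ-sym (+ᴹ-identityˡ _)) (λ a _ → ≈ᴹ-sym (*ₗ-zeroʳ a))
  ⟦ 1ᴱ ⟧ u = u
  isLinear 1ᴱ = linear M M id (λ _ _ → ≈ᴹ-refl) (λ _ _ → ≈ᴹ-refl)

endRing : LeftModule ℚ-ring 0ℓ 0ℓ → Ring 0ℓ 0ℓ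
endRing M = record
  { Carrier = LinearMap M M
  ; _≈_ = λ F G → ∀ u → ⟦ F ⟧ u ≈ᴹ ⟦ G ⟧ u
  ; _+_ = _+ᴱ_
  ; _*_ = _∘ᴱ_
  ; -_ = scale (ℚ.- 1ℚ) ∘ᴱ_
  ; 0# = 0ᴱ
  ; 1# = 1ᴱ
  ; isRing = record
    { +-isAbelianGroup = record
      { isGroup = record
        { isMonoid = record
          { isSemigroup = record
            { isMagma = record
              { isEquivalence = record
                { refl = λ _ → ≈ᴹ-refl
                ; sym = λ e u → ≈ᴹ-sym (e u)
                ; trans = λ e e′ u → ≈ᴹ-trans (e u) (e′ u) }
              ; ∙-cong = λ e e′ u → +ᴹ-cong (e u) (e′ u) }
            ; assoc = λ _ _ _ u → +ᴹ-assoc _ _ _ }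
          ; identity = (λ _ u → +ᴹ-identityˡ _) , λ _ u → +ᴹ-identityʳ _ }
        ; inverse = (λ F u → inverseˡ (⟦ F ⟧ u))
                  , λ F u → ≈ᴹ-trans (+ᴹ-comm _ _) (inverseˡ (⟦ F ⟧ u))
        ; ⁻¹-cong = λ e u → *ₗ-congˡ (e u) }
      ; comm = λ _ _ u → +ᴹ-comm _ _ }
    ; *-cong = λ {F} e e′ u → ≈ᴹ-trans (⟦⟧-cong F (e′ u)) (e _)
    ; *-assoc = λ _ _ _ u → ≈ᴹ-refl
    ; *-identity = (λ _ u → ≈ᴹ-refl) , λ _ u → ≈ᴹ-refl
    ; distrib = (λ F _ _ u → +ᴹ-homo F _ _) , λ _ _ _ u → ≈ᴹ-refl } }
  where
  open LeftModule M
  inverseˡ : ∀ u → (ℚ.- 1ℚ) *ₗ u +ᴹ u ≈ᴹ 0ᴹ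
  inverseˡ u = ≈ᴹ-trans (+ᴹ-congˡ (≈ᴹ-sym (*ₗ-identityˡ u)))
    (≈ᴹ-trans (≈ᴹ-sym (*ₗ-distribʳ u _ _)) (*ₗ-zeroˡ u))

module Matrices (R : RawRing 0ℓ 0ℓ) where
  open RawRing R
  open RawSemiringOps rawSemiring using (_^_) renaming (sum to ∑)

  Matrix : ℕ → Set
  Matrix n = Fin n → Fin n → Carrier

  -- Cofactor expansion along the first row.
  det : ∀ {n} → Matrix n → Carrier
  cofactor : ∀ {n} → Matrix (suc n) → Fin (suc n) → Carrier
  det {zero}  A = 1#
  det {suc n} A = ∑ (cofactor A)
  cofactor A j = (- 1#) ^ toℕ j * (A zero j * det λ i k → A (suc i) (punchIn j k))

data XY : Set where
  𝕩 𝕪 : XY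

ℚ[x,y] : LeftModule ℚ-ring 0ℓ 0ℓ
ℚ[x,y] = polyModule XY

ℚ[x,y]-ring : CommutativeRing 0ℓ 0ℓ
ℚ[x,y]-ring = polyRing XY

End : Ring 0ℓ 0ℓ
End = endRing ℚ[x,y]

open RawSemiringOps (RawRing.rawSemiring (CommutativeRing.rawRing ℚ[x,y]-ring)) using () renaming (_^_ to _^ᴾ_) public
open RawSemiringOps (RawRing.rawSemiring (Ring.rawRing End)) using () renaming (_^_ to _^ᴱ_; sum to ∑ᴱ) public

X Y : Poly XY
X = var 𝕩
Y = var 𝕪

multiplyBy : Poly XY → LinearMap ℚ[x,y] ℚ[x,y]
⟦ multiplyBy p ⟧ q = p ⊗ q
isLinear (multiplyBy p) = linear ℚ[x,y] ℚ[x,y] (⊗-cong ≋-refl) (⊗-distribˡ-⊕ p) λ a q →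
  ≋-trans (≋-sym (⊗-assoc _ _ _)) (≋-trans (⊗-cong (⊗-comm _ _) ≋-refl) (⊗-assoc _ _ _))

derivation : (XY → Poly XY) → LinearMap ℚ[x,y] ℚ[x,y]
⟦ derivation δ ⟧ = derive δ
isLinear (derivation δ) = linear ℚ[x,y] ℚ[x,y] (derive-cong δ) (λ _ _ → ≋-refl)
  λ a p → ≋-trans (⊕-cong (⊗-zeroˡ p) ≋-refl) (⊕-identityˡ _)

∂x ∂y D : LinearMap ℚ[x,y] ℚ[x,y]
∂x = derivation λ { 𝕩 → con 1ℚ ; 𝕪 → con 0ℚ }
∂y = derivation λ { 𝕩 → con 0ℚ ; 𝕪 → con 1ℚ }
D = ∂x +ᴱ ∂y

𝒢 : ℤ → LinearMap ℚ[x,y] ℚ[x,y]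
𝒢 (+ zero)    = 1ᴱ
𝒢 (+ suc r-1) = multiplyBy (Y ^ᴾ r) ∘ᴱ ∑ᴱ {r} λ i →
  let j = suc (toℕ i) in
  scale ((+ ((r ∸ 1) C (j ∸ 1)) ℚ./ (j !)) {{j ℕ.!≢0}}) ∘ᴱ multiplyBy (X ^ᴾ j) ∘ᴱ D ^ᴱ j
  where
  r = suc r-1
𝒢 -[1+ _ ]    = 0ᴱ

-- The ring of symmetric functions, as the polynomial ring on h₁, h₂, …;
-- the variable i stands for h_{i+1}.

Λ : CommutativeRing 0ℓ 0ℓ
Λ = polyRing ℕ

h : ℤ → Poly ℕ
h (+ zero)  = con 1ℚ
h (+ suc i) = var i
h -[1+ _ ]  = con 0ℚ

-- The algebra homomorphism with ρ (h r) = 𝒢 r. It respects _≋_ because the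
-- operators 𝒢 r commute.

ρ : Poly ℕ → LinearMap ℚ[x,y] ℚ[x,y]
ρ (con a) = scale a
ρ (var i) = 𝒢 (+ suc i)
ρ (p ⊕ q) = ρ p +ᴱ ρ q
ρ (p ⊗ q) = ρ p ∘ᴱ ρ q

jacobiTrudi : {A : Set} → (ℤ → A) → (ƛ : List ℕ) → Fin (length ƛ) → Fin (length ƛ) → A
jacobiTrudi a ƛ i j = a (+ List.lookup ƛ i ℤ.- + toℕ i ℤ.+ + toℕ j)

s : List ℕ → Poly ℕ
s ƛ = det (jacobiTrudi h ƛ) where open Matrices (CommutativeRing.rawRing Λ)

𝒢[_] : List ℕ → LinearMap ℚ[x,y] ℚ[x,y]
𝒢[ ƛ ] = ρ (s ƛ)

ρ-h : ∀ r → Ring._≈_ End (ρ (h r)) (𝒢 r)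
ρ-h (+ zero)  = ⊗-identityˡ
ρ-h (+ suc i) = λ _ → ≋-refl
ρ-h -[1+ _ ]  = ⊗-zeroˡ

𝒢[]-det : ∀ ƛ → Ring._≈_ End 𝒢[ ƛ ] (Matrices.det (Ring.rawRing End) (jacobiTrudi 𝒢 ƛ))
𝒢[]-det ƛ = ρ-det (jacobiTrudi h ƛ) (jacobiTrudi 𝒢 ƛ) λ i j →
  ρ-h (+ List.lookup ƛ i ℤ.- + toℕ i ℤ.+ + toℕ j)
  where
  open Ring End using (_≈_; -_; 1#; rawRing)
  module L = CommutativeRing Λ
  module L^ = RawSemiringOps (RawRing.rawSemiring L.rawRing)

  ρ-∑ : ∀ {n} (f : Fin n → Poly ℕ) (g : Fin n → LinearMap ℚ[x,y] ℚ[x,y]) →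
        (∀ i → ρ (f i) ≈ g i) → ρ (L^.sum f) ≈ ∑ᴱ g
  ρ-∑ {zero}  f g eq = ⊗-zeroˡ
  ρ-∑ {suc n} f g eq = λ u →
    ⊕-cong (eq zero u) (ρ-∑ (f ∘ suc) (g ∘ suc) (eq ∘ suc) u)

  ρ-sign : ∀ k → ρ ((L.- L.1#) L^.^ k) ≈ (- 1#) ^ᴱ k
  ρ-sign zero    = ⊗-identityˡ
  ρ-sign (suc k) = λ u →
    ⊗-cong ≋-refl (≋-trans (⊗-identityˡ _) (ρ-sign k u))

  ρ-det : ∀ {n} (A : Fin n → Fin n → Poly ℕ) (B : Fin n → Fin n → LinearMap ℚ[x,y] ℚ[x,y]) →
          (∀ i j → ρ (A i j) ≈ B i j) →
          ρ (Matrices.det L.rawRing A) ≈ Matrices.det rawRing B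
  ρ-det {zero}  A B eq = ⊗-identityˡ
  ρ-det {suc n} A B eq = ρ-∑ (Matrices.cofactor L.rawRing A) (Matrices.cofactor rawRing B) λ j u →
    ≋-trans (⟦⟧-cong (ρ ((L.- L.1#) L^.^ toℕ j))
      (≋-trans (⟦⟧-cong (ρ (A zero j))
        (ρ-det (λ i k → A (suc i) (punchIn j k)) (λ i k → B (suc i) (punchIn j k))
          (λ i k → eq (suc i) (punchIn j k)) u))
      (eq zero j _)))
    (ρ-sign (toℕ j) _)

-- A list of exponents (a₁, …, a_k) stands for the monomial z₁^a₁ ⋯ z_k^a_k, and
-- a power series is given by its coefficients. Lists which differ by trailing
-- zeros stand for the same monomial; quasisymmetric series agree on these.

Series : Set
Series = List ℕ → ℚ

degree : List ℕ → ℕ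
degree = sum

infixl 7 _·_

-- The Cauchy product: the coefficient of z^α is the sum of the f β g γ over all
-- β, γ with β + γ = α, enumerated one variable at a time.
_·_ : Series → Series → Series
(f · g) []      = f [] ℚ.* g []
(f · g) (a ∷ α) = ∑ {suc a} λ i → ((f ∘ (toℕ i ∷_)) · (g ∘ (a ∸ toℕ i ∷_))) α
  where open RawSemiringOps (RawRing.rawSemiring (Ring.rawRing ℚ-ring)) renaming (sum to ∑)

-- a times the sum of all monomials of degree r.
uniform : ℕ → ℚ → Series
uniform r a α = if does (degree α ℕ.≟ r) then a else 0ℚ

-- The inclusion of Λ into power series: h_r is the sum of all monomials of degree r.
ι : Poly ℕ → Series
ι (con a)   = uniform 0 a
ι (var i)   = uniform (suc i) 1ℚ
ι (p ⊕ q) α = ι p α ℚ.+ ι q α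
ι (p ⊗ q)   = ι p · ι q

compress : List ℕ → List ℕ
compress = filter λ a → ¬? (a ℕ.≟ 0)

-- The coefficient of z_{i₁}^a₁ ⋯ z_{iₖ}^aₖ, where i₁ < ⋯ < iₖ and all aⱼ > 0,
-- depends only on (a₁, …, aₖ).
Quasisymmetric : Series → Set
Quasisymmetric f = ∀ α β → compress α ≡ compress β → f α ≡ f β

Homogeneous : ℕ → Series → Set
Homogeneous n f = ∀ α → degree α ≢ n → f α ≡ 0ℚ

module _ where
  module ℚΣ = Algebra.Properties.CommutativeMonoid.Sum ℚ.+-0-commutativeMonoid
  module ℤΣ = Algebra.Properties.CommutativeMonoid.Sum ℤ.+-0-commutativeMonoid

  quasi : ∀ {f} → (∀ α → f α ≡ f (compress α)) → Quasisymmetric f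
  quasi {f} inv α β eq = trans (inv α) (trans (cong f eq) (sym (inv β)))

  quasi⁻¹ : ∀ {f} → Quasisymmetric f → ∀ α → f α ≡ f (compress α)
  quasi⁻¹ q α = q α (compress α) (sym (List.filter-idem _ α))

  degree-compress : ∀ α → degree (compress α) ≡ degree α
  degree-compress [] = refl
  degree-compress (zero ∷ α) = degree-compress α
  degree-compress (suc a ∷ α) = cong (ℕ._+_ (suc a)) (degree-compress α)

  compress-∷ : ∀ a {α β} → compress α ≡ compress β → compress (a ∷ α) ≡ compress (a ∷ β)
  compress-∷ zero    eq = eq
  compress-∷ (suc a) eq = cong (suc a ∷_) eq

  quasi-∷ : ∀ {f} a → Quasisymmetric f → Quasisymmetric (f ∘ (a ∷_))
  quasi-∷ a q α β eq = q (a ∷ α) (a ∷ β) (compress-∷ a {α} eq)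

  ·-cong : ∀ {f f′ g g′} → (∀ α → f α ≡ f′ α) → (∀ α → g α ≡ g′ α) → ∀ α → (f · g) α ≡ (f′ · g′) α
  ·-cong e e′ []      = cong₂ ℚ._*_ (e []) (e′ [])
  ·-cong e e′ (a ∷ α) = ℚΣ.sum-cong-≗ {suc a} λ i →
    ·-cong (λ β → e (toℕ i ∷ β)) (λ β → e′ (a ∸ toℕ i ∷ β)) α

  ·-compress : ∀ {f g} → Quasisymmetric f → Quasisymmetric g → ∀ α → (f · g) α ≡ (f · g) (compress α)
  ·-compress p q [] = refl
  ·-compress p q (zero ∷ α) = trans (ℚ.+-identityʳ _)
    (trans (·-cong (λ β → p (0 ∷ β) β refl) (λ β → q (0 ∷ β) β refl) α) (·-compress p q α))
  ·-compress p q (suc a ∷ α) = ℚΣ.sum-cong-≗ {suc (suc a)} λ i →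
    ·-compress (quasi-∷ (toℕ i) p) (quasi-∷ (suc a ∸ toℕ i) q) α

  ·-vanish : ∀ f g α → (∀ β γ → degree β ℕ.+ degree γ ≡ degree α → f β ℚ.* g γ ≡ 0ℚ) → (f · g) α ≡ 0ℚ
  ·-vanish f g [] v = v [] [] refl
  ·-vanish f g (a ∷ α) v = trans
    (ℚΣ.sum-cong-≗ {suc a} λ i → ·-vanish (f ∘ (toℕ i ∷_)) (g ∘ (a ∸ toℕ i ∷_)) α λ β γ eq → v (toℕ i ∷ β) (a ∸ toℕ i ∷ γ)
      (trans (CommutativeSemigroupProperties.interchange ℕ.+-commutativeSemigroup (toℕ i) _ _ _)
        (cong₂ ℕ._+_ (ℕ.m+[n∸m]≡n (Fin.toℕ≤pred[n] i)) eq)))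
    (ℚΣ.sum-replicate-zero (suc a))

·-quasisymmetric : ∀ {f g} → Quasisymmetric f → Quasisymmetric g → Quasisymmetric (f · g)
·-quasisymmetric p q = quasi (·-compress p q)

·-homogeneous : ∀ {m n f g} → Homogeneous m f → Homogeneous n g → Homogeneous (n ℕ.+ m) (f · g)
·-homogeneous {m} {n} {f} {g} p q α ne = ·-vanish f g α vanish
  where
  vanish : ∀ β γ → degree β ℕ.+ degree γ ≡ degree α → f β ℚ.* g γ ≡ 0ℚ
  vanish β γ eq with degree β ℕ.≟ m | degree γ ℕ.≟ n
  ... | no  β≢m | _        = trans (cong (ℚ._* g γ) (p β β≢m)) (ℚ.*-zeroˡ (g γ))
  ... | yes _   | no γ≢n   = trans (cong (f β ℚ.*_) (q γ γ≢n)) (ℚ.*-zeroʳ (f β))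
  ... | yes refl | yes refl with () ← ne (trans (sym eq) (ℕ.+-comm (degree β) (degree γ)))

uniform-quasisymmetric : ∀ r a → Quasisymmetric (uniform r a)
uniform-quasisymmetric r a = quasi λ α →
  cong (λ d → if does (d ℕ.≟ r) then a else 0ℚ) (sym (degree-compress α))

uniform-homogeneous : ∀ r a → Homogeneous r (uniform r a)
uniform-homogeneous r a α ne = cong (if_then a else 0ℚ) (dec-false (degree α ℕ.≟ r) ne)

ι-quasisymmetric : ∀ p → Quasisymmetric (ι p)
ι-quasisymmetric (con a) = uniform-quasisymmetric 0 a
ι-quasisymmetric (var i) = uniform-quasisymmetric (suc i) 1ℚ
ι-quasisymmetric (p ⊕ q) α β eq = cong₂ ℚ._+_ (ι-quasisymmetric p α β eq) (ι-quasisymmetric q α β eq)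
ι-quasisymmetric (p ⊗ q) = ·-quasisymmetric (ι-quasisymmetric p) (ι-quasisymmetric q)

record QSymElement (N : ℕ) : Set where
  field
    coeff          : Series
    quasisymmetric : Quasisymmetric coeff
    homogeneous    : Homogeneous N coeff

open QSymElement

QSym : ℕ → LeftModule ℚ-ring 0ℓ 0ℓ
QSym N = record
  { Carrierᴹ = QSymElement N
  ; _≈ᴹ_ = λ f g → ∀ α → coeff f α ≡ coeff g α
  ; _+ᴹ_ = λ f g → record
    { coeff = λ α → coeff f α ℚ.+ coeff g α
    ; quasisymmetric = λ α β eq → cong₂ ℚ._+_ (quasisymmetric f α β eq) (quasisymmetric g α β eq)
    ; homogeneous = λ α ne → cong₂ ℚ._+_ (homogeneous f α ne) (homogeneous g α ne) }
  ; _*ₗ_ = λ a f → record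
    { coeff = λ α → a ℚ.* coeff f α
    ; quasisymmetric = λ α β eq → cong (a ℚ.*_) (quasisymmetric f α β eq)
    ; homogeneous = λ α ne → trans (cong (a ℚ.*_) (homogeneous f α ne)) (ℚ.*-zeroʳ a) }
  ; 0ᴹ = record
    { coeff = λ _ → 0ℚ
    ; quasisymmetric = λ _ _ _ → refl
    ; homogeneous = λ _ _ → refl }
  ; -ᴹ_ = λ f → record
    { coeff = λ α → ℚ.- coeff f α
    ; quasisymmetric = λ α β eq → cong ℚ.-_ (quasisymmetric f α β eq)
    ; homogeneous = λ α ne → cong ℚ.-_ (homogeneous f α ne) }
  ; isLeftModule = record
    { isLeftSemimodule = record
      { +ᴹ-isCommutativeMonoid = record
        { isMonoid = record
          { isSemigroup = record
            { isMagma = record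
              { isEquivalence = record
                { refl = λ _ → refl
                ; sym = λ e α → sym (e α)
                ; trans = λ e e′ α → trans (e α) (e′ α) }
              ; ∙-cong = λ e e′ α → cong₂ ℚ._+_ (e α) (e′ α) }
            ; assoc = λ f g k α → ℚ.+-assoc (coeff f α) (coeff g α) (coeff k α) }
          ; identity = (λ f α → ℚ.+-identityˡ (coeff f α)) , λ f α → ℚ.+-identityʳ (coeff f α) }
        ; comm = λ f g α → ℚ.+-comm (coeff f α) (coeff g α) }
      ; isPreleftSemimodule = record
        { *ₗ-cong = λ e e′ α → cong₂ ℚ._*_ e (e′ α)
        ; *ₗ-zeroˡ = λ f α → ℚ.*-zeroˡ (coeff f α)
        ; *ₗ-distribʳ = λ f a b α → ℚ.*-distribʳ-+ (coeff f α) a b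
        ; *ₗ-identityˡ = λ f α → ℚ.*-identityˡ (coeff f α)
        ; *ₗ-assoc = λ a b f α → ℚ.*-assoc a b (coeff f α)
        ; *ₗ-zeroʳ = λ a α → ℚ.*-zeroʳ a
        ; *ₗ-distribˡ = λ a f g α → ℚ.*-distribˡ-+ a (coeff f α) (coeff g α) } }
    ; -ᴹ‿cong = λ e α → cong ℚ.-_ (e α)
    ; -ᴹ‿inverse = (λ f α → ℚ.+-inverseˡ (coeff f α)) , λ f α → ℚ.+-inverseʳ (coeff f α) } }

-- The homogeneous component of Λ of degree m, graded as a ring of power series.
record Λ⟨_⟩ (m : ℕ) : Set where
  field
    element     : Poly ℕ
    homogeneous : Homogeneous m (ι element)

infixr 7 _⊙_

_⊙_ : ∀ {m N} → Λ⟨ m ⟩ → QSymElement N → QSymElement (N ℕ.+ m)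
coeff          (g ⊙ f) = ι (Λ⟨_⟩.element g) · coeff f
quasisymmetric (g ⊙ f) = ·-quasisymmetric (ι-quasisymmetric (Λ⟨_⟩.element g)) (quasisymmetric f)
homogeneous    (g ⊙ f) = ·-homogeneous (Λ⟨_⟩.homogeneous g) (homogeneous f)

module _ where
  module ΛR = CommutativeRing Λ
  module Λ^ = RawSemiringOps (RawRing.rawSemiring ΛR.rawRing)
  open Matrices ΛR.rawRing

  -- Integer degrees accommodate h r = 0 for r < 0.
  Homogeneousᶻ : ℤ → Poly ℕ → Set
  Homogeneousᶻ e p = ∀ α → + degree α ≢ e → ι p α ≡ 0ℚ

  con-homogeneous : ∀ a → Homogeneousᶻ (+ 0) (con a)
  con-homogeneous a α ne = uniform-homogeneous 0 a α (ne ∘ cong (+_))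

  h-homogeneous : ∀ r → Homogeneousᶻ r (h r)
  h-homogeneous (+ zero)    = con-homogeneous 1ℚ
  h-homogeneous (+ suc r) α ne = uniform-homogeneous (suc r) 1ℚ α (ne ∘ cong (+_))
  h-homogeneous -[1+ _ ] α _ = zero-homogeneous α
    where
    zero-homogeneous : ∀ α → uniform 0 0ℚ α ≡ 0ℚ
    zero-homogeneous α with degree α ℕ.≡ᵇ 0
    ... | true  = refl
    ... | false = refl

  ⊗-homogeneous : ∀ {d e p q} → Homogeneousᶻ d p → Homogeneousᶻ e q → Homogeneousᶻ (d ℤ.+ e) (p ⊗ q)
  ⊗-homogeneous {d} {e} {p} {q} v w α ne = ·-vanish (ι p) (ι q) α vanish
    where
    vanish : ∀ β γ → degree β ℕ.+ degree γ ≡ degree α → ι p β ℚ.* ι q γ ≡ 0ℚ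
    vanish β γ eq with + degree β ℤ.≟ d | + degree γ ℤ.≟ e
    ... | no  β≢d  | _        = trans (cong (ℚ._* ι q γ) (v β β≢d)) (ℚ.*-zeroˡ (ι q γ))
    ... | yes _    | no γ≢e   = trans (cong (ι p β ℚ.*_) (w γ γ≢e)) (ℚ.*-zeroʳ (ι p β))
    ... | yes refl | yes refl with () ← ne (cong (+_) (sym eq))

  sum-homogeneous : ∀ {n e} (f : Fin n → Poly ℕ) → (∀ i → Homogeneousᶻ e (f i)) → Homogeneousᶻ e (Λ^.sum f)
  sum-homogeneous {zero}  f v α ne = h-homogeneous -[1+ 0 ] α λ ()
  sum-homogeneous {suc n} f v α ne =
    cong₂ ℚ._+_ (v zero α ne) (sum-homogeneous (f ∘ suc) (v ∘ suc) α ne)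

  sign-homogeneous : ∀ k → Homogeneousᶻ (+ 0) ((ΛR.- ΛR.1#) Λ^.^ k)
  sign-homogeneous zero    = con-homogeneous 1ℚ
  sign-homogeneous (suc k) = ⊗-homogeneous {p = ΛR.- ΛR.1#} {q = (ΛR.- ΛR.1#) Λ^.^ k}
    (⊗-homogeneous {p = con (ℚ.- 1ℚ)} {q = con 1ℚ} (con-homogeneous _) (con-homogeneous _))
    (sign-homogeneous k)

  det-homogeneous : ∀ {n} (A : Matrix n) (r c : Fin n → ℤ) →
    (∀ i j → Homogeneousᶻ (r i ℤ.+ c j) (A i j)) →
    Homogeneousᶻ (ℤΣ.sum r ℤ.+ ℤΣ.sum c) (det A)
  det-homogeneous {zero}  A r c v = con-homogeneous 1ℚ
  det-homogeneous {suc n} A r c v = sum-homogeneous (cofactor A) λ j →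
    subst (λ e → Homogeneousᶻ e (cofactor A j)) (deg j)
      (⊗-homogeneous {p = (ΛR.- ΛR.1#) Λ^.^ toℕ j} {q = A zero j ⊗ minor j} (sign-homogeneous (toℕ j))
        (⊗-homogeneous {p = A zero j} {q = minor j} (v zero j)
          (det-homogeneous (λ i k → A (suc i) (punchIn j k)) (r ∘ suc) (c ∘ punchIn j)
            λ i k → v (suc i) (punchIn j k))))
    where
    minor : Fin (suc n) → Poly ℕ
    minor j = det λ i k → A (suc i) (punchIn j k)
    deg : ∀ j → + 0 ℤ.+ ((r zero ℤ.+ c j) ℤ.+ (ℤΣ.sum (r ∘ suc) ℤ.+ ℤΣ.sum (c ∘ punchIn j)))
              ≡ ℤΣ.sum r ℤ.+ ℤΣ.sum c
    deg j = trans (ℤ.+-identityˡ _) (trans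
      (CommutativeSemigroupProperties.interchange ℤ.+-commutativeSemigroup (r zero) _ _ _)
      (cong (λ e → ℤΣ.sum r ℤ.+ e) (sym (ℤΣ.sum-remove {i = j} c))))

  lookup-sum : ∀ ƛ → ℤΣ.sum (λ i → + List.lookup ƛ i) ≡ + sum ƛ
  lookup-sum []      = refl
  lookup-sum (a ∷ ƛ) = cong (λ e → + a ℤ.+ e) (lookup-sum ƛ)

s-homogeneous : ∀ ƛ → Homogeneous (sum ƛ) (ι (s ƛ))
s-homogeneous ƛ α ne = subst (λ e → Homogeneousᶻ e (s ƛ)) total
  (det-homogeneous (jacobiTrudi h ƛ) r c (λ i j → h-homogeneous (r i ℤ.+ c j)))
  α (ne ∘ ℤ.+-injective)
  where
  r c : Fin (length ƛ) → ℤ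
  r i = + List.lookup ƛ i ℤ.- + toℕ i
  c j = + toℕ j
  cancel : ∀ i → r i ℤ.+ c i ≡ + List.lookup ƛ i
  cancel i = trans (ℤ.+-assoc (+ List.lookup ƛ i) (ℤ.- (+ toℕ i)) (+ toℕ i))
    (trans (cong (λ e → + List.lookup ƛ i ℤ.+ e) (ℤ.+-inverseˡ (+ toℕ i))) (ℤ.+-identityʳ _))
  total : ℤΣ.sum r ℤ.+ ℤΣ.sum c ≡ + sum ƛ
  total = trans (sym (ℤΣ.∑-distrib-+ r c))
    (trans (ℤΣ.sum-cong-≗ cancel) (lookup-sum ƛ))

-- The Schur function of a partition ƛ, given by the Jacobi–Trudi determinant,
-- in the component of degree |ƛ|.
schur : (ƛ : List ℕ) → Λ⟨ sum ƛ ⟩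
schur ƛ = record { element = s ƛ ; homogeneous = s-homogeneous ƛ }

fromℕ : ℕ → ℚ
fromℕ n = + n ℚ./ 1

words : ∀ {k} N → List (Vec (Fin k) N)
words zero    = [] ∷ []
words (suc N) = cartesianProductWith _∷_ (allFin _) (words N)

exponents : ∀ {k N} → Vec (Fin k) N → Vec ℕ k
exponents w = Vec.tabulate λ v → Vec.count (v Fin.≟_) w

-- i₁ ≤ ⋯ ≤ i_N with i_j < i_{j+1} for all j ∈ S, where the entries of S stand
-- for j = 1, …, N - 1.
Admissible : ∀ {k N} → Subset (N ∸ 1) → Vec (Fin k) N → Set
Admissible S             []          = ⊤
Admissible S             (i ∷ [])    = ⊤
Admissible (inside ∷ S)  (i ∷ j ∷ w) = i Fin.< j × Admissible S (j ∷ w)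
Admissible (outside ∷ S) (i ∷ j ∷ w) = i Fin.≤ j × Admissible S (j ∷ w)

admissible? : ∀ {k N} (S : Subset (N ∸ 1)) (w : Vec (Fin k) N) → Dec (Admissible S w)
admissible? S             []          = yes tt
admissible? S             (i ∷ [])    = yes tt
admissible? (inside ∷ S)  (i ∷ j ∷ w) = i Fin.<? j ×-dec admissible? S (j ∷ w)
admissible? (outside ∷ S) (i ∷ j ∷ w) = i Fin.≤? j ×-dec admissible? S (j ∷ w)

-- The coefficient of z^α in Σ z_{i₁} ⋯ z_{i_N} is the number of admissible words
-- with this monomial. They only involve the variables z₁, …, z_k for k = length α.
representations : ∀ N → Subset (N ∸ 1) → List ℕ → ℕ
representations N S α =
  length (filter (λ w → admissible? S w ×-dec Vec.≡-dec ℕ._≟_ (exponents w) (Vec.fromList α)) (words N))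

fundamental : ∀ N → Subset (N ∸ 1) → Series
fundamental N S α = fromℕ (representations N S α)

runs : ∀ {n} → ℕ → Subset n → List ℕ
runs a []            = a ∷ []
runs a (outside ∷ S) = runs (suc a) S
runs a (inside ∷ S)  = a ∷ runs 1 S

-- The composition of N whose partial sums below N are the elements of S.
composition : ∀ N → Subset (N ∸ 1) → List ℕ
composition zero    S = []
composition (suc n) S = runs 1 S

subsets : ∀ n → List (Subset n)
subsets zero    = [] ∷ []
subsets (suc n) = map (outside ∷_) (subsets n) ++ map (inside ∷_) (subsets n)

-- Σ_{T ⊆ S} (-1)^|S ∖ T| u T
mobius : ∀ {n} → (Subset n → ℚ) → Subset n → ℚ
mobius u []            = u []
mobius u (outside ∷ S) = mobius (u ∘ (outside ∷_)) S
mobius u (inside ∷ S)  = mobius (λ T → u (inside ∷ T) ℚ.- u (outside ∷ T)) S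

module _ where
  weakly : ∀ {n} → Subset n
  weakly = Vec.replicate _ outside

  count : ∀ {k N} → Fin k → Vec (Fin k) N → ℕ
  count v = Vec.count (v Fin.≟_)

  count-here : ∀ {k N} (i : Fin k) (w : Vec (Fin k) N) → count i (i ∷ w) ≡ suc (count i w)
  count-here i w rewrite dec-true (i Fin.≟ i) refl = refl

  count-there : ∀ {k N} {v i : Fin k} → v ≢ i → (w : Vec (Fin k) N) → count v (i ∷ w) ≡ count v w
  count-there {v = v} {i} ne w rewrite dec-false (v Fin.≟ i) ne = refl

  count-< : ∀ {k N} {v : Fin k} {w : Vec (Fin k) N} → VecAll.All (v Fin.<_) w → count v w ≡ 0
  count-< VecAll.[] = refl
  count-< {w = i ∷ w} (v<i VecAll.∷ v<w) = trans (count-there (Fin.<⇒≢ v<i) w) (count-< v<w)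

  count-tail : ∀ {k N N′} i (w : Vec (Fin k) N) (w′ : Vec (Fin k) N′) →
               (∀ v → count v (i ∷ w) ≡ count v (i ∷ w′)) → ∀ v → count v w ≡ count v w′
  count-tail i w w′ eq v with v Fin.≟ i | eq v
  ... | yes _ | e = ℕ.suc-injective e
  ... | no  _ | e = e

  -- Admissible words are weakly increasing.
  weaken : ∀ {k N} (S : Subset (N ∸ 1)) (w : Vec (Fin k) N) → Admissible S w → Admissible weakly w
  weaken S             []          a       = tt
  weaken S             (i ∷ [])    a       = tt
  weaken (inside ∷ S)  (i ∷ j ∷ w) (p , a) = ℕ.<⇒≤ p , weaken S (j ∷ w) a
  weaken (outside ∷ S) (i ∷ j ∷ w) (p , a) = p , weaken S (j ∷ w) a

  tail-weakly : ∀ {k N} (i : Fin k) (w : Vec (Fin k) N) → Admissible weakly (i ∷ w) → Admissible weakly w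
  tail-weakly i []      a       = tt
  tail-weakly i (j ∷ w) (_ , a) = a

  head-≤ : ∀ {k N} (i : Fin k) (w : Vec (Fin k) N) → Admissible weakly (i ∷ w) → VecAll.All (i Fin.≤_) w
  head-≤ i []      a       = VecAll.[]
  head-≤ i (j ∷ w) (p , a) = p VecAll.∷ VecAll.map (Fin.≤-trans p) (head-≤ j w a)

  head-< : ∀ {k N} (v i : Fin k) (w : Vec (Fin k) N) → v Fin.< i → Admissible weakly (i ∷ w) →
           count v (i ∷ w) ≡ 0
  head-< v i w v<i a = count-< (v<i VecAll.∷ VecAll.map (ℕ.<-≤-trans v<i) (head-≤ i w a))

  word-unique : ∀ {k N N′} (w : Vec (Fin k) N) (w′ : Vec (Fin k) N′) →
                Admissible weakly w → Admissible weakly w′ →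
                (∀ v → count v w ≡ count v w′) → Vec.toList w ≡ Vec.toList w′
  word-unique [] [] a a′ eq = refl
  word-unique [] (j ∷ w′) a a′ eq with () ← trans (eq j) (count-here j w′)
  word-unique (i ∷ w) [] a a′ eq with () ← trans (sym (eq i)) (count-here i w)
  word-unique (i ∷ w) (j ∷ w′) a a′ eq with Fin.<-cmp i j
  ... | tri< i<j _ _ with () ← trans (sym (count-here i w)) (trans (eq i) (head-< i j w′ i<j a′))
  ... | tri> _ _ j<i with () ← trans (sym (count-here j w′)) (trans (sym (eq j)) (head-< j i w j<i a))
  ... | tri≈ _ refl _ = cong (i ∷_)
    (word-unique w w′ (tail-weakly i w a) (tail-weakly i w′ a′) (count-tail i w w′ eq))

  word : ∀ {k} (α : Vec ℕ k) → Vec (Fin k) (Vec.sum α)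
  word []      = []
  word (a ∷ α) = Vec.replicate a zero Vec.++ Vec.map suc (word α)

  zero-weakly : ∀ {k N} (w : Vec (Fin (suc k)) N) → Admissible weakly w → Admissible weakly (zero ∷ w)
  zero-weakly []      a = tt
  zero-weakly (i ∷ w) a = ℕ.z≤n , a

  suc-weakly : ∀ {k N} (w : Vec (Fin k) N) → Admissible weakly w → Admissible weakly (Vec.map suc w)
  suc-weakly []          a       = tt
  suc-weakly (i ∷ [])    a       = tt
  suc-weakly (i ∷ j ∷ w) (p , a) = ℕ.s≤s p , suc-weakly (j ∷ w) a

  word-weakly : ∀ {k} (α : Vec ℕ k) → Admissible weakly (word α)
  word-weakly []      = tt
  word-weakly (a ∷ α) = go a
    where
    go : ∀ b → Admissible weakly (Vec.replicate b zero Vec.++ Vec.map suc (word α))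
    go zero    = suc-weakly (word α) (word-weakly α)
    go (suc b) = zero-weakly _ (go b)

  count-map-zero : ∀ {k N} (w : Vec (Fin k) N) → count zero (Vec.map suc w) ≡ 0
  count-map-zero []      = refl
  count-map-zero (i ∷ w) = count-map-zero w

  count-map-suc : ∀ {k N} (v : Fin k) (w : Vec (Fin k) N) → count (suc v) (Vec.map suc w) ≡ count v w
  count-map-suc v []      = refl
  count-map-suc v (i ∷ w) with v Fin.≟ i
  ... | yes refl = cong suc (count-map-suc v w)
  ... | no  _    = count-map-suc v w

  count-word : ∀ {k} (α : Vec ℕ k) v → count v (word α) ≡ Vec.lookup α v
  count-word (a ∷ α) zero = go a
    where
    go : ∀ b → count zero (Vec.replicate b zero Vec.++ Vec.map suc (word α)) ≡ b
    go zero    = count-map-zero (word α)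
    go (suc b) = cong suc (go b)
  count-word (a ∷ α) (suc v) = go a
    where
    go : ∀ b → count (suc v) (Vec.replicate b zero Vec.++ Vec.map suc (word α)) ≡ Vec.lookup α v
    go zero    = trans (count-map-suc v (word α)) (count-word α v)
    go (suc b) = go b

  exponents-word : ∀ {k} (α : Vec ℕ k) → exponents (word α) ≡ α
  exponents-word α = trans (Vec.tabulate-cong (count-word α)) (Vec.tabulate∘lookup α)

  exponents-count : ∀ {k N} {α : Vec ℕ k} {w : Vec (Fin k) N} → exponents w ≡ α →
                    ∀ v → count v w ≡ count v (word α)
  exponents-count {α = α} {w} eq v = trans (sym (Vec.lookup∘tabulate _ v))
    (trans (cong (λ β → Vec.lookup β v) eq) (sym (count-word α v)))

  words-complete : ∀ {k N} (w : Vec (Fin k) N) → w ∈ words N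
  words-complete []      = here refl
  words-complete (i ∷ w) = ∈.∈-cartesianProductWith⁺ _∷_ (∈.∈-allFin i) (words-complete w)

  words-unique : ∀ {k} N → Unique (words {k} N)
  words-unique zero    = [] ∷ []
  words-unique (suc N) = Unique.cartesianProductWith⁺ _∷_ Vec.∷-injective (Unique.allFin⁺ _) (words-unique N)

  word-unique-≡ : ∀ {k N} (w w′ : Vec (Fin k) N) → Admissible weakly w → Admissible weakly w′ →
                  (∀ v → count v w ≡ count v w′) → w ≡ w′
  word-unique-≡ w w′ a a′ eq = trans (sym (Vec.cast-is-id refl w))
    (Vec.toList-injective refl w w′ (word-unique w w′ a a′ eq))

  singleton : ∀ {A : Set} {a : A} {as} → Unique as → (∀ {b} → b ∈ as → b ≡ a) → a ∈ as → length as ≡ 1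
  singleton {as = _ ∷ []} u eq m = refl
  singleton {as = _ ∷ _ ∷ _} ((ne ∷ _) ∷ _) eq m
    with () ← ne (trans (eq (here refl)) (sym (eq (there (here refl)))))

  occurrences : ∀ {A : Set} {P : A → Set} (P? : ∀ a → Dec (P a)) {a as} → Unique as → a ∈ as →
    (∀ b → P b → b ≡ a) → (d : Dec (P a)) → length (filter P? as) ≡ (if does d then 1 else 0)
  occurrences P? {as = as} u m only (yes p) = singleton (Unique.filter⁺ P? u)
    (λ b∈ → only _ (proj₂ (∈.∈-filter⁻ P? {xs = as} b∈))) (∈.∈-filter⁺ P? m p)
  occurrences {P = P} P? {as = as} u m only (no ¬p) = cong length (List.filter-none P? {xs = as}
    (All.tabulate λ {b} _ p → ¬p (subst P (only b p) p)))

  fromℕ-if : ∀ b → fromℕ (if b then 1 else 0) ≡ (if b then 1ℚ else 0ℚ)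
  fromℕ-if true  = refl
  fromℕ-if false = refl

  descents : ∀ {k N} → Vec (Fin k) N → Subset (N ∸ 1)
  descents []          = []
  descents (i ∷ [])    = []
  descents (i ∷ j ∷ w) = does (i Fin.<? j) ∷ descents (j ∷ w)

  -- The indicator of S ⊆ T.
  included : ∀ {n} → Subset n → Subset n → ℚ
  included []            []            = 1ℚ
  included (outside ∷ S) (t ∷ T)       = included S T
  included (inside ∷ S)  (inside ∷ T)  = included S T
  included (inside ∷ S)  (outside ∷ T) = 0ℚ

  included-descents : ∀ {k N} (S : Subset (N ∸ 1)) (w : Vec (Fin k) N) → Admissible weakly w →
    included S (descents w) ≡ (if does (admissible? S w) then 1ℚ else 0ℚ)
  included-descents []            []          a = refl
  included-descents []            (i ∷ [])    a = refl
  included-descents (outside ∷ S) (i ∷ j ∷ w) (p , a)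
    rewrite dec-true (i Fin.≤? j) p = included-descents S (j ∷ w) a
  included-descents (inside ∷ S)  (i ∷ j ∷ w) (p , a) with does (i Fin.<? j)
  ... | true  = included-descents S (j ∷ w) a
  ... | false = refl

  descents-suc : ∀ {k N} (w : Vec (Fin k) N) → descents (Vec.map suc w) ≡ descents w
  descents-suc []          = refl
  descents-suc (i ∷ [])    = refl
  descents-suc (i ∷ j ∷ w) = cong (does (i Fin.<? j) ∷_) (descents-suc (j ∷ w))

  runs-zeros : ∀ {k} a b {N} (w : Vec (Fin k) N) →
    runs b (descents (Vec.replicate (suc a) zero Vec.++ Vec.map suc w)) ≡ a ℕ.+ b ∷ composition N (descents w)
  runs-zeros zero    b []      = refl
  runs-zeros zero    b (i ∷ w) = cong (λ S → b ∷ runs 1 S) (descents-suc (i ∷ w))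
  runs-zeros (suc a) b {N} w       = trans (runs-zeros a (suc b) w) (cong (_∷ composition N (descents w)) (ℕ.+-suc a b))

  composition-descents : ∀ {k} (α : Vec ℕ k) →
    composition (Vec.sum α) (descents (word α)) ≡ compress (Vec.toList α)
  composition-descents []          = refl
  composition-descents (zero ∷ α)  =
    trans (cong (composition (Vec.sum α)) (descents-suc (word α))) (composition-descents α)
  composition-descents (suc a ∷ α) =
    trans (runs-zeros a 1 (word α)) (cong₂ _∷_ (ℕ.+-comm a 1) (composition-descents α))

  sum-fromList : ∀ α → Vec.sum (Vec.fromList α) ≡ degree α
  sum-fromList []      = refl
  sum-fromList (a ∷ α) = cong (ℕ._+_ a) (sum-fromList α)

  fundamental-word : ∀ α (S : Subset (Vec.sum (Vec.fromList α) ∸ 1)) →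
    fundamental (Vec.sum (Vec.fromList α)) S α ≡ included S (descents (word (Vec.fromList α)))
  fundamental-word α S = trans (cong fromℕ number)
    (trans (fromℕ-if (does (admissible? S w))) (sym (included-descents S w (word-weakly β))))
    where
    β = Vec.fromList α
    w = word β
    number : representations (Vec.sum β) S α ≡ (if does (admissible? S w) then 1 else 0)
    number = occurrences _ (words-unique (Vec.sum β)) (words-complete w)
      (λ u (a , eq) → word-unique-≡ u w (weaken S u a) (word-weakly β) (exponents-count {w = u} eq))
      (map′ (λ a → a , exponents-word β) proj₁ (admissible? S w))

  fundamental-included : ∀ N α → degree α ≡ N →
    ∃[ T ] composition N T ≡ compress α × (∀ S → fundamental N S α ≡ included S T)
  fundamental-included N α eq with refl ← trans (sum-fromList α) eq =
    descents (word (Vec.fromList α)) ,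
    trans (composition-descents (Vec.fromList α)) (cong compress (Vec.toList∘fromList α)) ,
    fundamental-word α

  fundamental-homogeneous : ∀ N S → Homogeneous N (fundamental N S)
  fundamental-homogeneous N S α ne = cong fromℕ (cong length
    (List.filter-none _ {xs = words N} (All.tabulate λ {u} _ → impossible u)))
    where
    impossible : ∀ u → ¬ (Admissible S u × exponents u ≡ Vec.fromList α)
    impossible u (a , eq) = ne (trans (sym (sum-fromList α)) (trans (sym (Vec.length-toList (word (Vec.fromList α))))
      (trans (cong length 
        (sym (word-unique u (word (Vec.fromList α)) (weaken S u a) (word-weakly (Vec.fromList α)) (exponents-count {w = u} eq)))) (Vec.length-toList u))))

  runs-injective : ∀ {n} a (S T : Subset n) → runs a S ≡ runs a T → S ≡ T
  runs-≥ : ∀ {n} a (S : Subset n) {b β} → runs a S ≡ b ∷ β → a ℕ.≤ b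
  runs-≥ a []            refl = ℕ.≤-refl
  runs-≥ a (inside ∷ S)  refl = ℕ.≤-refl
  runs-≥ a (outside ∷ S) eq   = ℕ.≤-trans (ℕ.n≤1+n a) (runs-≥ (suc a) S eq)
  runs-injective a []            []            eq = refl
  runs-injective a (outside ∷ S) (outside ∷ T) eq = cong (outside ∷_) (runs-injective (suc a) S T eq)
  runs-injective a (inside ∷ S)  (inside ∷ T)  eq = cong (inside ∷_) (runs-injective 1 S T (List.∷-injectiveʳ eq))
  runs-injective a (outside ∷ S) (inside ∷ T)  eq = ⊥-elim (ℕ.1+n≰n (runs-≥ (suc a) S eq))
  runs-injective a (inside ∷ S)  (outside ∷ T) eq = ⊥-elim (ℕ.1+n≰n (runs-≥ (suc a) T (sym eq)))

  composition-injective : ∀ N {S T} → composition N S ≡ composition N T → S ≡ T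
  composition-injective zero    {[]} {[]} eq = refl
  composition-injective (suc n) eq = runs-injective 1 _ _ eq

  composition-positive : ∀ N S → All (0 ℕ.<_) (composition N S)
  composition-positive zero    S = []
  composition-positive (suc n) S = go 0 S
    where
    go : ∀ {n} a (S : Subset n) → All (0 ℕ.<_) (runs (suc a) S)
    go a []            = ℕ.z<s ∷ []
    go a (outside ∷ S) = go (suc a) S
    go a (inside ∷ S)  = ℕ.z<s ∷ go 0 S

  composition-degree : ∀ N S → degree (composition N S) ≡ N
  composition-degree zero    S = refl
  composition-degree (suc n) S = go 1 S
    where
    go : ∀ {n} a (S : Subset n) → degree (runs a S) ≡ a ℕ.+ n
    go a []            = refl
    go a (outside ∷ S) = trans (go (suc a) S) (sym (ℕ.+-suc a _))
    go a (inside ∷ S)  = cong (ℕ._+_ a) (go 1 S)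

  compress-positive : ∀ {α} → All (0 ℕ.<_) α → compress α ≡ α
  compress-positive pos = List.filter-all _ (All.map (λ p → ℕ.<⇒≢ p ∘ sym) pos)

  fundamental-composition : ∀ N S T → fundamental N S (composition N T) ≡ included S T
  fundamental-composition N S T =
    let T′ , eq , val = fundamental-included N (composition N T) (composition-degree N T) in
    trans (val S) (cong (included S)
      (composition-injective N (trans eq (compress-positive (composition-positive N T)))))

  fundamental-quasisymmetric : ∀ N S → Quasisymmetric (fundamental N S)
  fundamental-quasisymmetric N S = quasi λ α → inv α (degree α ℕ.≟ N)
    where
    inv : ∀ α → Dec (degree α ≡ N) → fundamental N S α ≡ fundamental N S (compress α)
    inv α (no ne) = trans (fundamental-homogeneous N S α ne)
      (sym (fundamental-homogeneous N S (compress α) (ne ∘ trans (sym (degree-compress α)))))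
    inv α (yes eq) = let T , c , val = fundamental-included N α eq in
      trans (val S) (trans (sym (fundamental-composition N S T)) (cong (fundamental N S) c))

F : ∀ N → Subset (N ∸ 1) → QSymElement N
F N S = record
  { coeff = fundamental N S
  ; quasisymmetric = fundamental-quasisymmetric N S
  ; homogeneous = fundamental-homogeneous N S }

∑[_] : (M : LeftModule ℚ-ring 0ℓ 0ℓ) → let open LeftModule M in
       {A : Set} → List A → (A → Carrierᴹ) → Carrierᴹ
∑[ M ] as u = foldr (λ a t → u a +ᴹ t) 0ᴹ as
  where open LeftModule M

-- The coefficient of F N S in the expansion of f in the basis of fundamental
-- quasisymmetric functions, obtained from the coefficients of f by Möbius inversion.
coordinate : ∀ {N} → QSymElement N → Subset (N ∸ 1) → ℚ
coordinate {N} f = mobius λ T → coeff f (composition N T)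

module _ where
  module _ (M : LeftModule ℚ-ring 0ℓ 0ℓ) where
    open LeftModule M

    ∑-cong : ∀ {A : Set} (as : List A) {u v} → (∀ a → u a ≈ᴹ v a) → ∑[ M ] as u ≈ᴹ ∑[ M ] as v
    ∑-cong []       eq = ≈ᴹ-refl
    ∑-cong (a ∷ as) eq = +ᴹ-cong (eq a) (∑-cong as eq)

    ∑-++ : ∀ {A : Set} (as bs : List A) u → ∑[ M ] (as ++ bs) u ≈ᴹ ∑[ M ] as u +ᴹ ∑[ M ] bs u
    ∑-++ []       bs u = ≈ᴹ-sym (+ᴹ-identityˡ _)
    ∑-++ (a ∷ as) bs u = ≈ᴹ-trans (+ᴹ-congˡ (∑-++ as bs u)) (≈ᴹ-sym (+ᴹ-assoc _ _ _))

    ∑-map : ∀ {A B : Set} (f : A → B) (as : List A) u → ∑[ M ] (map f as) u ≈ᴹ ∑[ M ] as (u ∘ f)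
    ∑-map f []       u = ≈ᴹ-refl
    ∑-map f (a ∷ as) u = +ᴹ-congˡ (∑-map f as u)

    ∑-subsets : ∀ n u → ∑[ M ] (subsets (suc n)) u ≈ᴹ
      ∑[ M ] (subsets n) (u ∘ (outside ∷_)) +ᴹ ∑[ M ] (subsets n) (u ∘ (inside ∷_))
    ∑-subsets n u = ≈ᴹ-trans (∑-++ (map (outside ∷_) (subsets n)) _ u)
      (+ᴹ-cong (∑-map (outside ∷_) (subsets n) u) (∑-map (inside ∷_) (subsets n) u))

    ∑-zero : ∀ {A : Set} (as : List A) {u} → (∀ a → u a ≈ᴹ 0ᴹ) → ∑[ M ] as u ≈ᴹ 0ᴹ
    ∑-zero []       eq = ≈ᴹ-refl
    ∑-zero (a ∷ as) eq = ≈ᴹ-trans (+ᴹ-cong (eq a) (∑-zero as eq)) (+ᴹ-identityˡ _)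

    ∑-+ : ∀ {A : Set} (as : List A) u v →
          ∑[ M ] as (λ a → u a +ᴹ v a) ≈ᴹ ∑[ M ] as u +ᴹ ∑[ M ] as v
    ∑-+ []       u v = ≈ᴹ-sym (+ᴹ-identityˡ _)
    ∑-+ (a ∷ as) u v = ≈ᴹ-trans (+ᴹ-congˡ (∑-+ as u v)) (+ᴹ-interchange {M} _ _ _ _)

    ∑-* : ∀ {A : Set} c (as : List A) u → ∑[ M ] as (λ a → c *ₗ u a) ≈ᴹ c *ₗ ∑[ M ] as u
    ∑-* c []       u = ≈ᴹ-sym (*ₗ-zeroʳ c)
    ∑-* c (a ∷ as) u = ≈ᴹ-trans (+ᴹ-congˡ (∑-* c as u)) (≈ᴹ-sym (*ₗ-distribˡ c _ _))

  mobius-cong : ∀ {n} {u v : Subset n → ℚ} → (∀ T → u T ≡ v T) → ∀ S → mobius u S ≡ mobius v S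
  mobius-cong eq []            = eq []
  mobius-cong eq (outside ∷ S) = mobius-cong (eq ∘ (outside ∷_)) S
  mobius-cong eq (inside ∷ S)  =
    mobius-cong (λ T → cong₂ ℚ._-_ (eq (inside ∷ T)) (eq (outside ∷ T))) S

  mobius-zero : ∀ {n} {u : Subset n → ℚ} → (∀ T → u T ≡ 0ℚ) → ∀ S → mobius u S ≡ 0ℚ
  mobius-zero eq []            = eq []
  mobius-zero eq (outside ∷ S) = mobius-zero (eq ∘ (outside ∷_)) S
  mobius-zero eq (inside ∷ S)  =
    mobius-zero (λ T → cong₂ ℚ._-_ (eq (inside ∷ T)) (eq (outside ∷ T))) S

  open CommutativeSemigroupProperties
    (CommutativeRing.+-commutativeSemigroup ℚ.+-*-commutativeRing) using (interchange)

  mobius-+ : ∀ {n} (u v : Subset n → ℚ) S → mobius (λ T → u T ℚ.+ v T) S ≡ mobius u S ℚ.+ mobius v S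
  mobius-+ u v []            = refl
  mobius-+ u v (outside ∷ S) = mobius-+ (u ∘ (outside ∷_)) (v ∘ (outside ∷_)) S
  mobius-+ u v (inside ∷ S)  = trans
    (mobius-cong (λ T → trans
      (cong (u (inside ∷ T) ℚ.+ v (inside ∷ T) ℚ.+_) (ℚ.neg-distrib-+ (u (outside ∷ T)) (v (outside ∷ T))))
      (interchange (u (inside ∷ T)) _ _ _)) S)
    (mobius-+ (λ T → u (inside ∷ T) ℚ.- u (outside ∷ T)) (λ T → v (inside ∷ T) ℚ.- v (outside ∷ T)) S)

  mobius-* : ∀ {n} c (u : Subset n → ℚ) S → mobius (λ T → c ℚ.* u T) S ≡ c ℚ.* mobius u S
  mobius-* c u []            = refl
  mobius-* c u (outside ∷ S) = mobius-* c (u ∘ (outside ∷_)) S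
  mobius-* c u (inside ∷ S)  = trans
    (mobius-cong (λ T → trans
      (cong (c ℚ.* u (inside ∷ T) ℚ.+_) (ℚ.neg-distribʳ-* c (u (outside ∷ T))))
      (sym (ℚ.*-distribˡ-+ c (u (inside ∷ T)) _))) S)
    (mobius-* c (λ T → u (inside ∷ T) ℚ.- u (outside ∷ T)) S)

  ℚ-module : LeftModule ℚ-ring 0ℓ 0ℓ
  ℚ-module = TensorUnit.leftModule

  mobius-inversion : ∀ {n} (u : Subset n → ℚ) T →
    ∑[ ℚ-module ] (subsets n) (λ S → mobius u S ℚ.* included S T) ≡ u T
  mobius-inversion u [] = trans (ℚ.+-identityʳ _) (ℚ.*-identityʳ (u []))
  mobius-inversion {suc n} u (inside ∷ T) = trans (∑-subsets ℚ-module n λ S → mobius u S ℚ.* included S (inside ∷ T))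
    (trans (cong₂ ℚ._+_ (mobius-inversion (u ∘ (outside ∷_)) T)
                        (mobius-inversion (λ T → u (inside ∷ T) ℚ.- u (outside ∷ T)) T))
      (trans (ℚ.+-comm b _) (trans (ℚ.+-assoc a _ _)
        (trans (cong (a ℚ.+_) (ℚ.+-inverseˡ b)) (ℚ.+-identityʳ a)))))
    where
    a = u (inside ∷ T)
    b = u (outside ∷ T)
  mobius-inversion {suc n} u (outside ∷ T) = trans (∑-subsets ℚ-module n λ S → mobius u S ℚ.* included S (outside ∷ T))
    (trans (cong₂ ℚ._+_ (mobius-inversion (u ∘ (outside ∷_)) T)
                        (∑-zero ℚ-module (subsets n) λ S → ℚ.*-zeroʳ (mobius u (inside ∷ S))))
      (ℚ.+-identityʳ _))

  kronecker : ∀ {n} → Subset n → Subset n → ℚ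
  kronecker []            []            = 1ℚ
  kronecker (outside ∷ S) (outside ∷ T) = kronecker S T
  kronecker (inside ∷ S)  (inside ∷ T)  = kronecker S T
  kronecker (outside ∷ S) (inside ∷ T)  = 0ℚ
  kronecker (inside ∷ S)  (outside ∷ T) = 0ℚ

  mobius-included : ∀ {n} (S T : Subset n) → mobius (included S) T ≡ kronecker S T
  mobius-included []            []            = refl
  mobius-included (outside ∷ S) (outside ∷ T) = mobius-included S T
  mobius-included (outside ∷ S) (inside ∷ T)  = mobius-zero (λ U → ℚ.+-inverseʳ (included S U)) T
  mobius-included (inside ∷ S)  (outside ∷ T) = mobius-zero (λ _ → refl) T
  mobius-included (inside ∷ S)  (inside ∷ T)  =
    trans (mobius-cong (λ U → ℚ.+-identityʳ (included S U)) T) (mobius-included S T)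

  coeff-∑ : ∀ {N} {A : Set} (as : List A) (u : A → QSymElement N) α →
            coeff (∑[ QSym N ] as u) α ≡ ∑[ ℚ-module ] as (λ a → coeff (u a) α)
  coeff-∑ []       u α = refl
  coeff-∑ (a ∷ as) u α = cong (coeff (u a) α ℚ.+_) (coeff-∑ as u α)

-- Every f is the combination of the F N S with these coordinates.
F-expansion : ∀ {N} (f : QSymElement N) → let open LeftModule (QSym N) in
  f ≈ᴹ ∑[ QSym N ] (subsets (N ∸ 1)) λ S → coordinate f S *ₗ F N S
F-expansion {N} f α = sym (trans (coeff-∑ (subsets (N ∸ 1)) _ α) (expand (degree α ℕ.≟ N)))
  where
  expand : Dec (degree α ≡ N) →
    ∑[ ℚ-module ] (subsets (N ∸ 1)) (λ S → coordinate f S ℚ.* fundamental N S α) ≡ coeff f α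
  expand (no ne) = trans
    (∑-zero ℚ-module (subsets (N ∸ 1)) λ S →
      trans (cong (coordinate f S ℚ.*_) (fundamental-homogeneous N S α ne)) (ℚ.*-zeroʳ (coordinate f S)))
    (sym (homogeneous f α ne))
  expand (yes eq) = let T , c , val = fundamental-included N α eq in trans
    (∑-cong ℚ-module (subsets (N ∸ 1)) λ S → cong (coordinate f S ℚ.*_) (val S))
    (trans (mobius-inversion (λ T → coeff f (composition N T)) T)
    (trans (cong (coeff f) c) (sym (quasi⁻¹ (quasisymmetric f) α))))

module _ where
  coordinate-F : ∀ N S T → coordinate (F N S) T ≡ kronecker S T
  coordinate-F N S T = trans (mobius-cong (fundamental-composition N S) T) (mobius-included S T)

Φ : ∀ N → LinearMap (QSym N) ℚ[x,y]
⟦ Φ N ⟧ f = ∑[ ℚ[x,y] ] (subsets (N ∸ 1)) λ S →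
  coordinate f S *ₗ (X ^ᴾ (∣ S ∣ ℕ.+ 1) ⊗ Y ^ᴾ (N ∸ ∣ S ∣))
  where open LeftModule ℚ[x,y]
isLinear (Φ N) = linear (QSym N) ℚ[x,y]
  (λ eq → ∑-cong ℚ[x,y] (subsets (N ∸ 1)) λ S →
    *ₗ-congʳ (mobius-cong (λ T → eq (composition N T)) S))
  (λ f g → ≈ᴹ-trans
    (∑-cong ℚ[x,y] (subsets (N ∸ 1)) λ S →
      ≈ᴹ-trans (*ₗ-congʳ (mobius-+ (coeff f ∘ composition N) (coeff g ∘ composition N) S))
        (*ₗ-distribʳ _ (coordinate f S) (coordinate g S)))
    (∑-+ ℚ[x,y] (subsets (N ∸ 1)) _ _))
  (λ c f → ≈ᴹ-trans
    (∑-cong ℚ[x,y] (subsets (N ∸ 1)) λ S →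
      ≈ᴹ-trans (*ₗ-congʳ (mobius-* c (coeff f ∘ composition N) S)) (*ₗ-assoc c (coordinate f S) _))
    (∑-* ℚ[x,y] c (subsets (N ∸ 1)) _))
  where open LeftModule ℚ[x,y]

-- Together with linearity and F-expansion this determines Φ N.
Φ-F : ∀ N S → ⟦ Φ N ⟧ (F N S) ≋ X ^ᴾ (∣ S ∣ ℕ.+ 1) ⊗ Y ^ᴾ (N ∸ ∣ S ∣)
Φ-F N S = ≈ᴹ-trans
  (∑-cong ℚ[x,y] (subsets (N ∸ 1)) λ T → *ₗ-congʳ (coordinate-F N S T))
  (select S λ T → X ^ᴾ (∣ T ∣ ℕ.+ 1) ⊗ Y ^ᴾ (N ∸ ∣ T ∣))
  where
  open LeftModule ℚ[x,y]
  select : ∀ {n} (S : Subset n) (u : Subset n → Poly XY) → ∑[ ℚ[x,y] ] (subsets n) (λ T → kronecker S T *ₗ u T) ≋ u S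
  select [] u = ≈ᴹ-trans (+ᴹ-identityʳ _) (*ₗ-identityˡ _)
  select {suc n} (outside ∷ S) u = ≈ᴹ-trans (∑-subsets ℚ[x,y] n _)
    (≈ᴹ-trans (+ᴹ-cong (select S (u ∘ (outside ∷_))) (∑-zero ℚ[x,y] (subsets n) λ T → *ₗ-zeroˡ _))
      (+ᴹ-identityʳ _))
  select {suc n} (inside ∷ S) u = ≈ᴹ-trans (∑-subsets ℚ[x,y] n _)
    (≈ᴹ-trans (+ᴹ-cong (∑-zero ℚ[x,y] (subsets n) λ T → *ₗ-zeroˡ _) (select S (u ∘ (inside ∷_))))
      (+ᴹ-identityˡ _))

IsPartition : List ℕ → Set
IsPartition ƛ = All (0 ℕ.<_) ƛ × Linked ℕ._≥_ ƛ

partitions : ℕ → List (List ℕ)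
partitions n = filter (linked? ℕ._≥?_) (map (composition n) (subsets (n ∸ 1)))

module _ where
  subsets-complete : ∀ {n} (S : Subset n) → S ∈ subsets n
  subsets-complete []            = here refl
  subsets-complete (outside ∷ S) = ∈.∈-++⁺ˡ (∈.∈-map⁺ (outside ∷_) (subsets-complete S))
  subsets-complete {suc n} (inside ∷ S) =
    ∈.∈-++⁺ʳ (map (outside ∷_) (subsets n)) (∈.∈-map⁺ (inside ∷_) (subsets-complete S))

  subsets-unique : ∀ n → Unique (subsets n)
  subsets-unique zero    = [] ∷ []
  subsets-unique (suc n) = Unique.++⁺
    (Unique.map⁺ Vec.∷-injectiveʳ (subsets-unique n))
    (Unique.map⁺ Vec.∷-injectiveʳ (subsets-unique n))
    λ (m , m′) → clash (∈.∈-map⁻ (outside ∷_) m) (∈.∈-map⁻ (inside ∷_) m′)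
    where
    clash : ∀ {S : Subset (suc n)} → ∃[ T ] T ∈ subsets n × S ≡ outside ∷ T →
            ∃[ T ] T ∈ subsets n × S ≡ inside ∷ T → ⊥
    clash (_ , _ , refl) (_ , _ , ())

partitions-unique : ∀ n → Unique (partitions n)
partitions-unique n = Unique.filter⁺ (linked? ℕ._≥?_)
  (Unique.map⁺ (composition-injective n) (subsets-unique (n ∸ 1)))

∈-partitions : ∀ {n ƛ} → ƛ ∈ partitions n ⇔ (IsPartition ƛ × sum ƛ ≡ n)
∈-partitions {n} {ƛ} = mk⇔ to from
  where
  to : ƛ ∈ partitions n → IsPartition ƛ × sum ƛ ≡ n
  to m with m′ , decreasing ← ∈.∈-filter⁻ (linked? ℕ._≥?_) {xs = map (composition n) (subsets (n ∸ 1))} m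
    with S , _ , refl ← ∈.∈-map⁻ (composition n) m′ =
    (composition-positive n S , decreasing) , composition-degree n S
  from : IsPartition ƛ × sum ƛ ≡ n → ƛ ∈ partitions n
  from ((positive , decreasing) , eq) =
    let S , c , _ = fundamental-included n ƛ eq in
    ∈.∈-filter⁺ (linked? ℕ._≥?_)
      (subst (_∈ map (composition n) (subsets (n ∸ 1))) (trans c (compress-positive positive))
        (∈.∈-map⁺ (composition n) (subsets-complete S)))
      decreasing

-- s ƛ s μ = Σ_ν c ν s ν, the sum running over the partitions of |ƛ| + |μ|.
IsLittlewoodRichardson : (ƛ μ : List ℕ) → (List ℕ → ℚ) → Set
IsLittlewoodRichardson ƛ μ c =
  s ƛ ⊗ s μ ≋ ∑[ polyModule ℕ ] (partitions (sum ƛ ℕ.+ sum μ)) λ ν → con (c ν) ⊗ s ν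

{-# OPTIONS --safe #-}
module Submission where

{- Put t = x/y and Z = y - x. Since F_{N,S}(1^k) is the coefficient of t^k in
   t^{|S|+1}/(1-t)^{N+1}, the map Φ_N is f ↦ Z^{N+1} Σ_{k≥1} f(1^k) t^k, and multiplying f by g
   ∈ Λ_m multiplies the k-th term by Z^m g(1^k). On the other side D Z = 0, and 𝒢_r multiplies
   Z^{N+1} t^k by Z^r h_r(1^k). To stay with polynomials, write k = κ + 1 and expand κ ↦
   f(1^{κ+1}) in binomial coefficients: C(κ,a) corresponds to x^{a+1} Z^{N-a}. A function of κ
   determines its binomial expansion, so it suffices that both sides of the theorem come from
   the same function of N and κ. The same argument shows that the 𝒢_r commute, hence that ρ is
   well defined on Λ, which turns the Littlewood–Richardson rule for s_λ s_μ into the one for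
   𝒢_λ 𝒢_μ. -}

open import Defs
open import Algebra.Bundles using (CommutativeRing)
import Algebra.Properties.CommutativeMonoid.Sum
import Algebra.Properties.CommutativeSemigroup as CommutativeSemigroupProperties
import Algebra.Properties.Ring
import Algebra.Properties.Semiring.Sum
open import Algebra.Solver.Ring.NaturalCoefficients.Default (CommutativeRing.commutativeSemiring ℚ[x,y]-ring)
  using (solve; _:=_; _:+_; _:*_) renaming (con to :con)
open import Data.Bool using (if_then_else_)
open import Data.Fin using (Fin; zero; suc; toℕ)
open import Data.Fin.Subset using (Subset; inside; outside; ∣_∣)
import Data.Fin.Subset.Properties as Subset
import Data.Integer as ℤ
import Data.Integer.Properties as ℤ
open import Data.List using (List; []; _∷_)
open import Data.Nat as ℕ using (ℕ; zero; suc; _+_; _*_; _∸_; _≤_; _<_; _⊔_; s≤s; _!; NonZero)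
open import Data.Nat.Combinatorics using (_C_; nCk+nC[k+1]≡[n+1]C[k+1])
open import Data.Nat.ListAction using (sum)
import Data.Nat.Properties as ℕ
open import Data.Product using (_×_; _,_; ∃-syntax)
open import Data.Rational as ℚ using (ℚ; 0ℚ; 1ℚ)
import Data.Rational.Properties as ℚ
import Data.Rational.Unnormalised as ℚᵘ
import Data.Rational.Unnormalised.Properties as ℚᵘ
open import Data.Vec using ([]; _∷_)
open import Function using (_∘_; flip; const)
open import Relation.Binary.PropositionalEquality using (_≡_; _≢_; refl; sym; trans; cong; cong₂; module ≡-Reasoning)
import Relation.Binary.Reasoning.Setoid
open import Relation.Nullary using (yes; no; does; contradiction)
open LinearMap using (⟦_⟧; ⟦⟧-cong; +ᴹ-homo; *ₗ-homo; 0ᴹ-homo)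
open QSymElement using (coeff; quasisymmetric; homogeneous)

module P = CommutativeRing ℚ[x,y]-ring
module PΣ = Algebra.Properties.CommutativeMonoid.Sum P.+-commutativeMonoid
module P*Σ = Algebra.Properties.Semiring.Sum P.semiring
module ≋-Reasoning = Relation.Binary.Reasoning.Setoid P.setoid
module ℚR = Algebra.Properties.Ring ℚ-ring

open CommutativeSemigroupProperties (CommutativeRing.+-commutativeSemigroup ℚ.+-*-commutativeRing)
  using () renaming (interchange to +-interchange; x∙yz≈y∙xz to +-swap)
open CommutativeSemigroupProperties (CommutativeRing.*-commutativeSemigroup ℚ.+-*-commutativeRing)
  using () renaming (interchange to *-interchange; x∙yz≈y∙xz to *-swap)
open CommutativeSemigroupProperties P.*-commutativeSemigroup using () renaming (x∙yz≈y∙xz to ⊗-swap)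

-- Sums over antidiagonals

-- The recursion shifts the first index, so neither `n ∸ i` nor a bound `i ≤ n` enters the
-- reindexing laws below.
conv : ℕ → (ℕ → ℕ → ℚ) → ℚ
conv zero    φ = φ 0 0
conv (suc n) φ = φ 0 (suc n) ℚ.+ conv n (φ ∘ suc)

conv-cong : ∀ n {φ ψ : ℕ → ℕ → ℚ} → (∀ i j → φ i j ≡ ψ i j) → conv n φ ≡ conv n ψ
conv-cong zero    eq = eq 0 0
conv-cong (suc n) eq = cong₂ ℚ._+_ (eq 0 (suc n)) (conv-cong n (eq ∘ suc))

-- For summands that agree only on the antidiagonal itself; this makes the total degree available
-- inside a sum.
conv-cong-total : ∀ n {φ ψ : ℕ → ℕ → ℚ} → (∀ i j → i + j ≡ n → φ i j ≡ ψ i j) → conv n φ ≡ conv n ψ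
conv-cong-total zero    eq = eq 0 0 refl
conv-cong-total (suc n) eq = cong₂ ℚ._+_ (eq 0 (suc n) refl)
  (conv-cong-total n λ i j e → eq (suc i) j (cong suc e))

conv-+ : ∀ n (φ ψ : ℕ → ℕ → ℚ) → conv n (λ i j → φ i j ℚ.+ ψ i j) ≡ conv n φ ℚ.+ conv n ψ
conv-+ zero    φ ψ = refl
conv-+ (suc n) φ ψ = trans (cong (φ 0 (suc n) ℚ.+ ψ 0 (suc n) ℚ.+_) (conv-+ n (φ ∘ suc) (ψ ∘ suc)))
  (+-interchange (φ 0 (suc n)) (ψ 0 (suc n)) _ _)

conv-*ˡ : ∀ n a (φ : ℕ → ℕ → ℚ) → conv n (λ i j → a ℚ.* φ i j) ≡ a ℚ.* conv n φ
conv-*ˡ zero    a φ = refl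
conv-*ˡ (suc n) a φ = trans (cong (a ℚ.* φ 0 (suc n) ℚ.+_) (conv-*ˡ n a (φ ∘ suc)))
  (sym (ℚ.*-distribˡ-+ a (φ 0 (suc n)) _))

conv-*ʳ : ∀ n a (φ : ℕ → ℕ → ℚ) → conv n (λ i j → φ i j ℚ.* a) ≡ conv n φ ℚ.* a
conv-*ʳ n a φ = trans (conv-cong n λ i j → ℚ.*-comm (φ i j) a)
  (trans (conv-*ˡ n a φ) (ℚ.*-comm a _))

conv-zero : ∀ n → conv n (λ _ _ → 0ℚ) ≡ 0ℚ
conv-zero zero    = refl
conv-zero (suc n) = trans (ℚ.+-identityˡ _) (conv-zero n)

-- The definition splits off i = 0; splitting off j = 0 instead is what reversing the antidiagonal
-- requires.
conv-last : ∀ n (φ : ℕ → ℕ → ℚ) → conv (suc n) φ ≡ φ (suc n) 0 ℚ.+ conv n (λ i j → φ i (suc j))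
conv-last zero    φ = ℚ.+-comm (φ 0 1) (φ 1 0)
conv-last (suc n) φ = trans (cong (φ 0 (suc (suc n)) ℚ.+_) (conv-last n (φ ∘ suc)))
  (+-swap (φ 0 (suc (suc n))) (φ (suc (suc n)) 0) _)

conv-flip : ∀ n (φ : ℕ → ℕ → ℚ) → conv n φ ≡ conv n (flip φ)
conv-flip zero    φ = refl
conv-flip (suc n) φ = trans (cong (φ 0 (suc n) ℚ.+_) (conv-flip n (φ ∘ suc)))
  (sym (conv-last n (flip φ)))

-- Both sides run over all i + j + k = n. Splitting off i = 0 leaves the same boundary terms on
-- either side, and the shifted sums agree by induction.
conv-assoc : ∀ n (φ : ℕ → ℕ → ℕ → ℚ) →
  conv n (λ m k → conv m λ i j → φ i j k) ≡ conv n (λ i m → conv m λ j k → φ i j k)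
conv-assoc zero    φ = refl
conv-assoc (suc n) φ = begin
  φ 0 0 (suc n) ℚ.+ conv n (λ m k → φ 0 (suc m) k ℚ.+ conv m λ i j → φ (suc i) j k)
    ≡⟨ cong (φ 0 0 (suc n) ℚ.+_) (conv-+ n (λ m k → φ 0 (suc m) k) λ m k → conv m λ i j → φ (suc i) j k) ⟩
  φ 0 0 (suc n) ℚ.+ (conv n (λ m k → φ 0 (suc m) k) ℚ.+ conv n (λ m k → conv m λ i j → φ (suc i) j k))
    ≡⟨ cong (λ t → φ 0 0 (suc n) ℚ.+ (conv n (λ m k → φ 0 (suc m) k) ℚ.+ t)) (conv-assoc n (φ ∘ suc)) ⟩
  φ 0 0 (suc n) ℚ.+ (conv n (λ m k → φ 0 (suc m) k) ℚ.+ conv n (λ i m → conv m λ j k → φ (suc i) j k))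
    ≡⟨ ℚ.+-assoc (φ 0 0 (suc n)) _ _ ⟨
  φ 0 0 (suc n) ℚ.+ conv n (λ m k → φ 0 (suc m) k) ℚ.+ conv n (λ i m → conv m λ j k → φ (suc i) j k) ∎
  where open ≡-Reasoning

-- Both sides run over all i + j + k + l = n. Associativity isolates i and leaves an exchange of j
-- and k in a threefold sum, which is a reversal of its inner antidiagonal.
conv-interchange : ∀ n (φ : ℕ → ℕ → ℕ → ℕ → ℚ) →
  conv n (λ m m′ → conv m λ i j → conv m′ λ k l → φ i j k l) ≡
  conv n (λ m m′ → conv m λ i k → conv m′ λ j l → φ i j k l)
conv-interchange n φ = begin
  conv n (λ m m′ → conv m λ i j → conv m′ λ k l → φ i j k l)
    ≡⟨ conv-assoc n (λ i j m′ → conv m′ λ k l → φ i j k l) ⟩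
  conv n (λ i p → conv p λ j m′ → conv m′ λ k l → φ i j k l)
    ≡⟨ conv-cong n (λ i p → swap p (φ i)) ⟩
  conv n (λ i p → conv p λ k m′ → conv m′ λ j l → φ i j k l)
    ≡⟨ conv-assoc n (λ i k m′ → conv m′ λ j l → φ i j k l) ⟨
  conv n (λ m m′ → conv m λ i k → conv m′ λ j l → φ i j k l) ∎
  where
  open ≡-Reasoning
  swap : ∀ p (ψ : ℕ → ℕ → ℕ → ℚ) →
    conv p (λ j m → conv m λ k l → ψ j k l) ≡ conv p (λ k m → conv m λ j l → ψ j k l)
  swap p ψ = trans (sym (conv-assoc p ψ))
    (trans (conv-cong p λ m l → conv-flip m λ j k → ψ j k l) (conv-assoc p (flip ψ)))

-- Valued in ℚ and structurally recursive, so that it serves as a coefficient and reduces when both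
-- indices are shifted.
δ : ℕ → ℕ → ℚ
δ zero    zero    = 1ℚ
δ zero    (suc n) = 0ℚ
δ (suc m) zero    = 0ℚ
δ (suc m) (suc n) = δ m n

δ-refl : ∀ n → δ n n ≡ 1ℚ
δ-refl zero    = refl
δ-refl (suc n) = δ-refl n

δ-≢ : ∀ {m n} → m ≢ n → δ m n ≡ 0ℚ
δ-≢ {zero}  {zero}  m≢n = contradiction refl m≢n
δ-≢ {zero}  {suc n} m≢n = refl
δ-≢ {suc m} {zero}  m≢n = refl
δ-≢ {suc m} {suc n} m≢n = δ-≢ (m≢n ∘ cong suc)

δ-subst : ∀ m n (u : ℕ → ℚ) → δ m n ℚ.* u n ≡ δ m n ℚ.* u m
δ-subst zero    zero    u = refl
δ-subst zero    (suc n) u = trans (ℚ.*-zeroˡ (u (suc n))) (sym (ℚ.*-zeroˡ (u 0)))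
δ-subst (suc m) zero    u = trans (ℚ.*-zeroˡ (u 0)) (sym (ℚ.*-zeroˡ (u (suc m))))
δ-subst (suc m) (suc n) u = δ-subst m n (u ∘ suc)

-- The coefficient of q^k in the product of q^m and q^n.
conv-δ : ∀ m n k → conv k (λ i j → δ m i ℚ.* δ n j) ≡ δ (m + n) k
conv-δ zero n zero    = ℚ.*-identityˡ (δ n 0)
conv-δ zero n (suc k) = trans (cong₂ ℚ._+_ (ℚ.*-identityˡ (δ n (suc k)))
    (trans (conv-cong k λ i j → ℚ.*-zeroˡ (δ n j)) (conv-zero k)))
  (ℚ.+-identityʳ _)
conv-δ (suc m) n zero    = ℚ.*-zeroˡ (δ n 0)
conv-δ (suc m) n (suc k) = trans (cong₂ ℚ._+_ (ℚ.*-zeroˡ (δ n (suc k))) (conv-δ m n k))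
  (ℚ.+-identityˡ _)

-- Binomial coefficients

-- `ℚ._/_` normalises by a gcd and is stuck on variables, so the equation is checked on unnormalised
-- fractions, where it is integer arithmetic.
fromℕ-+ : ∀ m n → fromℕ (m + n) ≡ fromℕ m ℚ.+ fromℕ n
fromℕ-+ m n = ℚ.toℚᵘ-injective (ℚᵘ.≃-trans (ℚ.toℚᵘ-fromℚᵘ (ℚᵘ.mkℚᵘ (ℤ.+ (m + n)) 0))
  (ℚᵘ.≃-trans (ℚᵘ.*≡* (cong (ℤ._* ℤ.+ 1) (sym (cong₂ ℤ._+_ (ℤ.*-identityʳ (ℤ.+ m)) (ℤ.*-identityʳ (ℤ.+ n))))))
  (ℚᵘ.≃-sym (ℚᵘ.≃-trans (ℚ.toℚᵘ-homo-+ (fromℕ m) (fromℕ n))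
    (ℚᵘ.+-cong (ℚ.toℚᵘ-fromℚᵘ (ℚᵘ.mkℚᵘ (ℤ.+ m) 0)) (ℚ.toℚᵘ-fromℚᵘ (ℚᵘ.mkℚᵘ (ℤ.+ n) 0)))))))

/-*-fromℕ : ∀ m n .{{_ : NonZero n}} → (ℤ.+ m ℚ./ n) ℚ.* fromℕ n ≡ fromℕ m
/-*-fromℕ m n@(suc k) = ℚ.toℚᵘ-injective (ℚᵘ.≃-trans (ℚ.toℚᵘ-homo-* (ℤ.+ m ℚ./ n) (fromℕ n))
  (ℚᵘ.≃-trans (ℚᵘ.*-cong (ℚ.toℚᵘ-fromℚᵘ (ℚᵘ.mkℚᵘ (ℤ.+ m) k)) (ℚ.toℚᵘ-fromℚᵘ (ℚᵘ.mkℚᵘ (ℤ.+ n) 0)))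
  (ℚᵘ.≃-trans (ℚᵘ.*≡* (trans (ℤ.*-identityʳ _) (cong (λ t → ℤ.+ m ℤ.* ℤ.+ t) (sym (ℕ.*-identityʳ n)))))
  (ℚᵘ.≃-sym (ℚ.toℚᵘ-fromℚᵘ (ℚᵘ.mkℚᵘ (ℤ.+ m) 0))))))

fromℕ-suc : ∀ n → fromℕ (suc n) ≡ 1ℚ ℚ.+ fromℕ n
fromℕ-suc = fromℕ-+ 1

fromℕ-* : ∀ m n → fromℕ (m * n) ≡ fromℕ m ℚ.* fromℕ n
fromℕ-* zero    n = sym (ℚ.*-zeroˡ (fromℕ n))
fromℕ-* (suc m) n = trans (fromℕ-+ n (m * n)) (trans (cong (fromℕ n ℚ.+_) (fromℕ-* m n))
  (trans (cong (ℚ._+ fromℕ m ℚ.* fromℕ n) (sym (ℚ.*-identityˡ (fromℕ n))))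
  (trans (sym (ℚ.*-distribʳ-+ (fromℕ n) 1ℚ (fromℕ m))) (cong (ℚ._* fromℕ n) (sym (fromℕ-suc m))))))

-- Pascal's rule holds by definition, which suits the inductions; `fromℕ-C` links this to the `_C_`
-- in the definition of `𝒢`.
choose : ℕ → ℕ → ℚ
choose n       zero    = 1ℚ
choose zero    (suc k) = 0ℚ
choose (suc n) (suc k) = choose n k ℚ.+ choose n (suc k)

fromℕ-C : ∀ n k → fromℕ (n C k) ≡ choose n k
fromℕ-C n       zero    = refl
fromℕ-C zero    (suc k) = refl
fromℕ-C (suc n) (suc k) = trans (cong fromℕ (sym (nCk+nC[k+1]≡[n+1]C[k+1] n k)))
  (trans (fromℕ-+ (n C k) _) (cong₂ ℚ._+_ (fromℕ-C n k) (fromℕ-C n (suc k))))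

choose-above : ∀ n k → choose n (suc k + n) ≡ 0ℚ
choose-above zero    k = refl
choose-above (suc n) k rewrite ℕ.+-suc k n = cong₂ ℚ._+_ (choose-above n k) (choose-above n (suc k))

choose-diagonal : ∀ n → choose n n ≡ 1ℚ
choose-diagonal zero    = refl
choose-diagonal (suc n) = cong₂ ℚ._+_ (choose-diagonal n) (choose-above n 0)

-- Induction by Pascal's rule: of the k + 2 copies of `a`, one is set aside, and the induction
-- hypothesis absorbs the other k + 1 as well as the multiple of `b`.
choose-absorb : ∀ n k → fromℕ (suc k) ℚ.* choose (suc n) (suc k) ≡ fromℕ (suc n) ℚ.* choose n k
choose-absorb zero zero = refl
choose-absorb zero (suc k) = trans (ℚ.*-zeroʳ (fromℕ (suc (suc k)))) refl
choose-absorb (suc n) zero = begin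
  1ℚ ℚ.* (1ℚ ℚ.+ choose (suc n) 1)  ≡⟨ ℚ.*-distribˡ-+ 1ℚ 1ℚ (choose (suc n) 1) ⟩
  1ℚ ℚ.+ 1ℚ ℚ.* choose (suc n) 1    ≡⟨ cong (1ℚ ℚ.+_) (choose-absorb n 0) ⟩
  1ℚ ℚ.+ fromℕ (suc n) ℚ.* 1ℚ       ≡⟨ cong (1ℚ ℚ.+_) (ℚ.*-identityʳ (fromℕ (suc n))) ⟩
  1ℚ ℚ.+ fromℕ (suc n)              ≡⟨ fromℕ-suc (suc n) ⟨
  fromℕ (suc (suc n))               ≡⟨ ℚ.*-identityʳ _ ⟨
  fromℕ (suc (suc n)) ℚ.* 1ℚ        ∎
  where open ≡-Reasoning
choose-absorb (suc n) (suc k) = begin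
  fromℕ (2 + k) ℚ.* (a ℚ.+ b)                          ≡⟨ ℚ.*-distribˡ-+ (fromℕ (2 + k)) a b ⟩
  fromℕ (2 + k) ℚ.* a ℚ.+ fromℕ (2 + k) ℚ.* b          ≡⟨ cong₂ ℚ._+_ step (choose-absorb n (suc k)) ⟩
  a ℚ.+ fromℕ (1 + n) ℚ.* choose n k ℚ.+ fromℕ (1 + n) ℚ.* choose n (1 + k)
    ≡⟨ ℚ.+-assoc a (fromℕ (1 + n) ℚ.* choose n k) _ ⟩
  a ℚ.+ (fromℕ (1 + n) ℚ.* choose n k ℚ.+ fromℕ (1 + n) ℚ.* choose n (1 + k))
    ≡⟨ cong (a ℚ.+_) (ℚ.*-distribˡ-+ (fromℕ (1 + n)) (choose n k) (choose n (1 + k))) ⟨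
  a ℚ.+ fromℕ (1 + n) ℚ.* a                            ≡⟨ one+ n a ⟨
  fromℕ (2 + n) ℚ.* a                                  ∎
  where
  open ≡-Reasoning
  a = choose (suc n) (suc k)
  b = choose (suc n) (suc (suc k))
  one+ : ∀ n a → fromℕ (2 + n) ℚ.* a ≡ a ℚ.+ fromℕ (1 + n) ℚ.* a
  one+ n a = trans (cong (ℚ._* a) (fromℕ-suc (suc n)))
    (trans (ℚ.*-distribʳ-+ a 1ℚ (fromℕ (suc n))) (cong (ℚ._+ fromℕ (suc n) ℚ.* a) (ℚ.*-identityˡ a)))
  step : fromℕ (2 + k) ℚ.* a ≡ a ℚ.+ fromℕ (1 + n) ℚ.* choose n k
  step = trans (one+ k a) (cong (a ℚ.+_) (choose-absorb n k))

fromℕ-cancelˡ : ∀ n {p q} → fromℕ (suc n) ℚ.* p ≡ fromℕ (suc n) ℚ.* q → p ≡ q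
fromℕ-cancelˡ n {p} {q} eq = trans (sym (undo p)) (trans (cong ((ℤ.+ 1 ℚ./ suc n) ℚ.*_) eq) (undo q))
  where
  undo : ∀ p → (ℤ.+ 1 ℚ./ suc n) ℚ.* (fromℕ (suc n) ℚ.* p) ≡ p
  undo p = trans (sym (ℚ.*-assoc (ℤ.+ 1 ℚ./ suc n) (fromℕ (suc n)) p))
    (trans (cong (ℚ._* p) (/-*-fromℕ 1 (suc n))) (ℚ.*-identityˡ p))

-- Both sides count pairs of disjoint subsets of sizes r and k in a set of size r + n. In the
-- induction, the factor r + 1 lets absorption lower r in each of the three binomials that contain
-- it.
choose-choose : ∀ r n k → choose (r + n) r ℚ.* choose n k ≡ choose (r + k) r ℚ.* choose (r + n) (r + k)
choose-choose zero    n k = refl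
choose-choose (suc r) n k = fromℕ-cancelˡ r (begin
  fromℕ (suc r) ℚ.* (choose (suc r + n) (suc r) ℚ.* choose n k)
    ≡⟨ ℚ.*-assoc (fromℕ (suc r)) (choose (suc r + n) (suc r)) (choose n k) ⟨
  fromℕ (suc r) ℚ.* choose (suc r + n) (suc r) ℚ.* choose n k
    ≡⟨ cong (ℚ._* choose n k) (choose-absorb (r + n) r) ⟩
  fromℕ (suc (r + n)) ℚ.* choose (r + n) r ℚ.* choose n k
    ≡⟨ ℚ.*-assoc (fromℕ (suc (r + n))) (choose (r + n) r) (choose n k) ⟩
  fromℕ (suc (r + n)) ℚ.* (choose (r + n) r ℚ.* choose n k)
    ≡⟨ cong (fromℕ (suc (r + n)) ℚ.*_) (choose-choose r n k) ⟩
  fromℕ (suc (r + n)) ℚ.* (choose (r + k) r ℚ.* choose (r + n) (r + k))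
    ≡⟨ *-swap (fromℕ (suc (r + n))) (choose (r + k) r) (choose (r + n) (r + k)) ⟩
  choose (r + k) r ℚ.* (fromℕ (suc (r + n)) ℚ.* choose (r + n) (r + k))
    ≡⟨ cong (choose (r + k) r ℚ.*_) (choose-absorb (r + n) (r + k)) ⟨
  choose (r + k) r ℚ.* (fromℕ (suc (r + k)) ℚ.* choose (suc r + n) (suc r + k))
    ≡⟨ *-swap (choose (r + k) r) (fromℕ (suc (r + k))) (choose (suc r + n) (suc r + k)) ⟩
  fromℕ (suc (r + k)) ℚ.* (choose (r + k) r ℚ.* choose (suc r + n) (suc r + k))
    ≡⟨ ℚ.*-assoc (fromℕ (suc (r + k))) (choose (r + k) r) (choose (suc r + n) (suc r + k)) ⟨
  fromℕ (suc (r + k)) ℚ.* choose (r + k) r ℚ.* choose (suc r + n) (suc r + k)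
    ≡⟨ cong (ℚ._* choose (suc r + n) (suc r + k)) (choose-absorb (r + k) r) ⟨
  fromℕ (suc r) ℚ.* choose (suc r + k) (suc r) ℚ.* choose (suc r + n) (suc r + k)
    ≡⟨ ℚ.*-assoc (fromℕ (suc r)) (choose (suc r + k) (suc r)) (choose (suc r + n) (suc r + k)) ⟩
  fromℕ (suc r) ℚ.* (choose (suc r + k) (suc r) ℚ.* choose (suc r + n) (suc r + k)) ∎)
  where open ≡-Reasoning

-- The range of summation is allowed to exceed q, so that Pascal's rule applies without boundary terms.
vandermonde : ∀ {m q} n t → q < m →
  ℚΣ.sum {m} (λ i → choose q (toℕ i) ℚ.* choose n (t + toℕ i)) ≡ choose (q + n) (q + t)
vandermonde {suc m} {zero} n t q<m = begin
  1ℚ ℚ.* choose n (t + 0) ℚ.+ ℚΣ.sum {m} (λ i → 0ℚ ℚ.* choose n (t + suc (toℕ i)))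
    ≡⟨ cong₂ ℚ._+_ (ℚ.*-identityˡ (choose n (t + 0)))
         (trans (ℚΣ.sum-cong-≗ {m} λ i → ℚ.*-zeroˡ (choose n (t + suc (toℕ i)))) (ℚΣ.sum-replicate-zero m)) ⟩
  choose n (t + 0) ℚ.+ 0ℚ  ≡⟨ ℚ.+-identityʳ _ ⟩
  choose n (t + 0)         ≡⟨ cong (choose n) (ℕ.+-identityʳ t) ⟩
  choose n t               ∎
  where open ≡-Reasoning
vandermonde {suc m} {suc q} n t (s≤s q<m) = begin
  x ℚ.+ ℚΣ.sum {m} (λ i → (choose q (toℕ i) ℚ.+ choose q (suc (toℕ i))) ℚ.* y i)
    ≡⟨ cong (x ℚ.+_) (trans (ℚΣ.sum-cong-≗ {m} λ i → ℚ.*-distribʳ-+ (y i) (choose q (toℕ i)) (choose q (suc (toℕ i))))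
         (ℚΣ.∑-distrib-+ {m} (λ i → choose q (toℕ i) ℚ.* y i) (λ i → choose q (suc (toℕ i)) ℚ.* y i))) ⟩
  x ℚ.+ (ℚΣ.sum {m} (λ i → choose q (toℕ i) ℚ.* y i) ℚ.+ ℚΣ.sum {m} (λ i → choose q (suc (toℕ i)) ℚ.* y i))
    ≡⟨ +-swap x (ℚΣ.sum {m} λ i → choose q (toℕ i) ℚ.* y i) _ ⟩
  ℚΣ.sum {m} (λ i → choose q (toℕ i) ℚ.* y i) ℚ.+ (x ℚ.+ ℚΣ.sum {m} (λ i → choose q (suc (toℕ i)) ℚ.* y i))
    ≡⟨ cong₂ ℚ._+_
         (trans (ℚΣ.sum-cong-≗ {m} λ i → cong (λ e → choose q (toℕ i) ℚ.* choose n e) (ℕ.+-suc t (toℕ i)))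
           (vandermonde n (suc t) q<m))
         (vandermonde n t (ℕ.m<n⇒m<1+n q<m)) ⟩
  choose (q + n) (q + suc t) ℚ.+ choose (q + n) (q + t)
    ≡⟨ ℚ.+-comm (choose (q + n) (q + suc t)) _ ⟩
  choose (q + n) (q + t) ℚ.+ choose (q + n) (q + suc t)
    ≡⟨ cong (λ e → choose (q + n) (q + t) ℚ.+ choose (q + n) e) (ℕ.+-suc q t) ⟩
  choose (suc q + n) (suc q + t) ∎
  where
  open ≡-Reasoning
  x = 1ℚ ℚ.* choose n (t + 0)
  y = λ i → choose n (t + suc (toℕ i))

-- Principal specialisations of series

-- The sum of the coefficients of f at the monomials of degree n in k variables,
-- that is, the value of the degree n part of f at z₁ = ⋯ = z_k = 1.
evaluate : ℕ → ℕ → Series → ℚ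
evaluate zero    n f = δ 0 n ℚ.* f []
evaluate (suc k) n f = conv n λ i j → evaluate k j (f ∘ (i ∷_))

evaluate-cong : ∀ k n {f g : Series} → (∀ α → f α ≡ g α) → evaluate k n f ≡ evaluate k n g
evaluate-cong zero    n eq = cong (δ 0 n ℚ.*_) (eq [])
evaluate-cong (suc k) n eq = conv-cong n λ i j → evaluate-cong k j (eq ∘ (i ∷_))

evaluate-+ : ∀ k n f g → evaluate k n (λ α → f α ℚ.+ g α) ≡ evaluate k n f ℚ.+ evaluate k n g
evaluate-+ zero    n f g = ℚ.*-distribˡ-+ (δ 0 n) (f []) (g [])
evaluate-+ (suc k) n f g = trans (conv-cong n λ i j → evaluate-+ k j (f ∘ (i ∷_)) (g ∘ (i ∷_)))
  (conv-+ n (λ i j → evaluate k j (f ∘ (i ∷_))) (λ i j → evaluate k j (g ∘ (i ∷_))))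

evaluate-conv : ∀ k n m (F : ℕ → ℕ → Series) →
  evaluate k n (λ α → conv m λ i j → F i j α) ≡ conv m λ i j → evaluate k n (F i j)
evaluate-conv k n zero    F = refl
evaluate-conv k n (suc m) F = trans (evaluate-+ k n (F 0 (suc m)) _)
  (cong (evaluate k n (F 0 (suc m)) ℚ.+_) (evaluate-conv k n m (F ∘ suc)))

evaluate-zero : ∀ k n f → (∀ α → degree α ≡ n → f α ≡ 0ℚ) → evaluate k n f ≡ 0ℚ
evaluate-zero zero    zero    f eq = cong (1ℚ ℚ.*_) (eq [] refl)
evaluate-zero zero    (suc n) f eq = ℚ.*-zeroˡ (f [])
evaluate-zero (suc k) n f eq = trans
  (conv-cong-total n λ i j e → evaluate-zero k j (f ∘ (i ∷_)) λ α d → eq (i ∷ α) (trans (cong (i +_) d) e))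
  (conv-zero n)

evaluate-degree : ∀ k n (φ : ℕ → ℚ) → evaluate k n (φ ∘ degree) ≡ φ n ℚ.* evaluate k n (const 1ℚ)
evaluate-degree zero zero φ = trans (ℚ.*-identityˡ (φ 0)) (sym (ℚ.*-identityʳ (φ 0)))
evaluate-degree zero (suc n) φ = trans (ℚ.*-zeroˡ (φ 0)) (sym (ℚ.*-zeroʳ (φ (suc n))))
evaluate-degree (suc k) n φ = trans
  (conv-cong-total n λ i j e → trans (evaluate-degree k j (φ ∘ (i +_))) (cong (λ d → φ d ℚ.* evaluate k j (const 1ℚ)) e))
  (conv-*ˡ n (φ n) λ i j → evaluate k j (const 1ℚ))

-- This counts monomials: one of degree n + 1 in κ + 2 variables either omits the first variable or
-- is divisible by it, which is Pascal's rule.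
evaluate-const : ∀ κ n → evaluate (suc κ) n (const 1ℚ) ≡ choose (n + κ) n
evaluate-const zero    zero    = refl
evaluate-const zero    (suc n) = trans (cong₂ ℚ._+_ (ℚ.*-zeroˡ 1ℚ) (evaluate-const zero n))
  (trans (ℚ.+-identityˡ (choose (n + 0) n)) (trans (sym (ℚ.+-identityʳ _)) (cong (choose (n + 0) n ℚ.+_) (sym top))))
  where
  top : choose (n + 0) (suc n) ≡ 0ℚ
  top rewrite ℕ.+-identityʳ n = choose-above n 0
evaluate-const (suc κ) zero    = evaluate-const κ zero
evaluate-const (suc κ) (suc n) = trans (cong₂ ℚ._+_ (evaluate-const κ (suc n)) (evaluate-const (suc κ) n))
  (trans (ℚ.+-comm (choose (suc n + κ) (suc n)) _)
    (cong (λ e → choose (n + suc κ) n ℚ.+ choose e (suc n)) (sym (ℕ.+-suc n κ))))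

uniform-δ : ∀ r a n → (if does (n ℕ.≟ r) then a else 0ℚ) ≡ δ r n ℚ.* a
uniform-δ zero    a zero    = sym (ℚ.*-identityˡ a)
uniform-δ zero    a (suc n) = sym (ℚ.*-zeroˡ a)
uniform-δ (suc r) a zero    = sym (ℚ.*-zeroˡ a)
uniform-δ (suc r) a (suc n) = uniform-δ r a n

evaluate-uniform : ∀ r a n κ → evaluate (suc κ) n (uniform r a) ≡ δ r n ℚ.* a ℚ.* choose (n + κ) n
evaluate-uniform r a n κ = trans (evaluate-degree (suc κ) n λ n → if does (n ℕ.≟ r) then a else 0ℚ)
  (cong₂ ℚ._*_ (uniform-δ r a n) (evaluate-const κ n))

-- Trades the sum over `Fin` with `∸` in the Cauchy product for an antidiagonal sum, to which the
-- laws of `conv` apply.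
·-∷ : ∀ f g a α → (f · g) (a ∷ α) ≡ conv a λ i j → ((f ∘ (i ∷_)) · (g ∘ (j ∷_))) α
·-∷ f g a α = sum-conv a λ i j → ((f ∘ (i ∷_)) · (g ∘ (j ∷_))) α
  where
  sum-conv : ∀ n (φ : ℕ → ℕ → ℚ) → ℚΣ.sum {suc n} (λ i → φ (toℕ i) (n ∸ toℕ i)) ≡ conv n φ
  sum-conv zero    φ = ℚ.+-identityʳ (φ 0 0)
  sum-conv (suc n) φ = cong (φ 0 (suc n) ℚ.+_) (sum-conv n (φ ∘ suc))

-- Setting all variables to 1 is multiplicative, degree by degree. The interchange swaps two ways to
-- split the degree: first between the first variable and the rest, or first between the two
-- factors.
evaluate-· : ∀ k n f g → evaluate k n (f · g) ≡ conv n λ i j → evaluate k i f ℚ.* evaluate k j g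
evaluate-· zero n f g = begin
  δ 0 n ℚ.* (f [] ℚ.* g [])
    ≡⟨ cong (ℚ._* (f [] ℚ.* g [])) (conv-δ 0 0 n) ⟨
  conv n (λ i j → δ 0 i ℚ.* δ 0 j) ℚ.* (f [] ℚ.* g [])
    ≡⟨ conv-*ʳ n (f [] ℚ.* g []) (λ i j → δ 0 i ℚ.* δ 0 j) ⟨
  conv n (λ i j → δ 0 i ℚ.* δ 0 j ℚ.* (f [] ℚ.* g []))
    ≡⟨ conv-cong n (λ i j → *-interchange (δ 0 i) (δ 0 j) (f []) (g [])) ⟩
  conv n (λ i j → δ 0 i ℚ.* f [] ℚ.* (δ 0 j ℚ.* g [])) ∎
  where open ≡-Reasoning
evaluate-· (suc k) n f g = begin
  conv n (λ a j → evaluate k j ((f · g) ∘ (a ∷_)))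
    ≡⟨ conv-cong n (λ a j → trans (evaluate-cong k j (·-∷ f g a))
         (evaluate-conv k j a λ i i′ → (f ∘ (i ∷_)) · (g ∘ (i′ ∷_)))) ⟩
  conv n (λ a j → conv a λ i i′ → evaluate k j ((f ∘ (i ∷_)) · (g ∘ (i′ ∷_))))
    ≡⟨ conv-cong n (λ a j → conv-cong a λ i i′ → evaluate-· k j (f ∘ (i ∷_)) (g ∘ (i′ ∷_))) ⟩
  conv n (λ a j → conv a λ i i′ → conv j λ l l′ → evaluate k l (f ∘ (i ∷_)) ℚ.* evaluate k l′ (g ∘ (i′ ∷_)))
    ≡⟨ conv-interchange n (λ i i′ l l′ → evaluate k l (f ∘ (i ∷_)) ℚ.* evaluate k l′ (g ∘ (i′ ∷_))) ⟩
  conv n (λ m m′ → conv m λ i l → conv m′ λ i′ l′ → evaluate k l (f ∘ (i ∷_)) ℚ.* evaluate k l′ (g ∘ (i′ ∷_)))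
    ≡⟨ conv-cong n (λ m m′ → trans
         (conv-cong m λ i l → conv-*ˡ m′ (evaluate k l (f ∘ (i ∷_))) λ i′ l′ → evaluate k l′ (g ∘ (i′ ∷_)))
         (conv-*ʳ m _ λ i l → evaluate k l (f ∘ (i ∷_)))) ⟩
  conv n (λ m m′ → evaluate (suc k) m f ℚ.* evaluate (suc k) m′ g) ∎
  where open ≡-Reasoning

evaluate-0 : ∀ k {f} → Quasisymmetric f → evaluate k 0 f ≡ f []
evaluate-0 zero    {f} q = ℚ.*-identityˡ (f [])
evaluate-0 (suc k) {f} q = trans (evaluate-0 k (quasi-∷ 0 q)) (q (0 ∷ []) [] refl)

-- Quasisymmetric series at equal variables

-- Σ_T u T · choose k (t + |T|)
binomialSum : ∀ n → (Subset n → ℚ) → ℕ → ℕ → ℚ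
binomialSum zero    u t k = u [] ℚ.* choose k t
binomialSum (suc n) u t k = binomialSum n (u ∘ (outside ∷_)) t k ℚ.+ binomialSum n (u ∘ (inside ∷_)) (suc t) k

binomialSum-zero : ∀ n u t → binomialSum n u (suc t) 0 ≡ 0ℚ
binomialSum-zero zero    u t = ℚ.*-zeroʳ (u [])
binomialSum-zero (suc n) u t =
  cong₂ ℚ._+_ (binomialSum-zero n (u ∘ (outside ∷_)) t) (binomialSum-zero n (u ∘ (inside ∷_)) (suc t))

binomialSum-suc : ∀ n u t k → binomialSum n u (suc t) (suc k) ≡ binomialSum n u t k ℚ.+ binomialSum n u (suc t) k
binomialSum-suc zero    u t k = ℚ.*-distribˡ-+ (u []) (choose k t) (choose k (suc t))
binomialSum-suc (suc n) u t k = trans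
  (cong₂ ℚ._+_ (binomialSum-suc n (u ∘ (outside ∷_)) t k) (binomialSum-suc n (u ∘ (inside ∷_)) (suc t) k))
  (+-interchange (binomialSum n (u ∘ (outside ∷_)) t k) _ _ _)

-- `f ∘ runs 1` lists the coefficients of f in the basis of monomial quasisymmetric functions. The
-- one indexed by T has |T| + 1 parts and takes the value C(k, |T| + 1) at k ones, whence the index
-- 1. In the induction on k, the first variable has exponent zero or a positive one.
evaluate-quasisymmetric : ∀ k n {f} → Quasisymmetric f →
  evaluate k (suc n) f ≡ binomialSum n (f ∘ runs 1) 1 k
evaluate-quasisymmetric zero n {f} q = trans (ℚ.*-zeroˡ (f [])) (sym (binomialSum-zero n (f ∘ runs 1) 0))
evaluate-quasisymmetric (suc k) n {f} q = begin
  evaluate k (suc n) (f ∘ (0 ∷_)) ℚ.+ conv n (λ i j → evaluate k j (f ∘ (suc i ∷_)))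
    ≡⟨ cong₂ ℚ._+_ (evaluate-cong k (suc n) λ α → q (0 ∷ α) α refl) (trans
         (conv-cong n λ i j → evaluate-cong k j λ α → cong (λ b → f (b ∷ α)) (ℕ.+-comm 1 i)) (positive n 1 q)) ⟩
  evaluate k (suc n) f ℚ.+ binomialSum n (f ∘ runs 1) 0 k
    ≡⟨ cong (ℚ._+ binomialSum n (f ∘ runs 1) 0 k) (evaluate-quasisymmetric k n q) ⟩
  binomialSum n (f ∘ runs 1) 1 k ℚ.+ binomialSum n (f ∘ runs 1) 0 k
    ≡⟨ ℚ.+-comm (binomialSum n (f ∘ runs 1) 1 k) _ ⟩
  binomialSum n (f ∘ runs 1) 0 k ℚ.+ binomialSum n (f ∘ runs 1) 1 k
    ≡⟨ binomialSum-suc n (f ∘ runs 1) 0 k ⟨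
  binomialSum n (f ∘ runs 1) 1 (suc k) ∎
  where
  open ≡-Reasoning
  -- The first variable now has exponent at least `a`: either exactly `a`, and a new part begins
  -- (`inside`), or more (`outside`). Only the |T| later parts still choose among the other k
  -- variables, whence the index 0.
  positive : ∀ n a {f} → Quasisymmetric f →
    conv n (λ i j → evaluate k j (f ∘ (i + a ∷_))) ≡ binomialSum n (f ∘ runs a) 0 k
  positive zero    a {f} q = trans (evaluate-0 k (quasi-∷ a q)) (sym (ℚ.*-identityʳ (f (a ∷ []))))
  positive (suc n) a {f} q = trans
    (cong₂ ℚ._+_ (evaluate-quasisymmetric k n (quasi-∷ a q))
      (trans (conv-cong n λ i j → evaluate-cong k j λ α → cong (λ b → f (b ∷ α)) (sym (ℕ.+-suc i a)))
        (positive n (suc a) q)))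
    (ℚ.+-comm (binomialSum n (f ∘ (a ∷_) ∘ runs 1) 1 k) _)

-- Constants in polynomials

≡⇒≋ : ∀ {I : Set} {p q : Poly I} → p ≡ q → p ≋ q
≡⇒≋ refl = ≋-refl

con-cong : ∀ {a b} {p : Poly XY} → a ≡ b → con a ⊗ p ≋ con b ⊗ p
con-cong refl = ≋-refl

con-con : ∀ a b (p : Poly XY) → con a ⊗ (con b ⊗ p) ≋ con (a ℚ.* b) ⊗ p
con-con a b p = ≋-trans (≋-sym (⊗-assoc _ _ _)) (⊗-cong (≋-sym (con-⊗ a b)) ≋-refl)

-- The operators 𝒢 on monomials in x and Z = y - x

Z : Poly XY
Z = Y ⊕ con (ℚ.- 1ℚ) ⊗ X

-1+1 : con (ℚ.- 1ℚ) ⊕ con 1ℚ ≋ con {XY} 0ℚ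
-1+1 = ≋-sym (con-⊕ (ℚ.- 1ℚ) 1ℚ)

Y≋X⊕Z : Y ≋ X ⊕ Z
Y≋X⊕Z = ≋-sym (begin
  X ⊕ (Y ⊕ con (ℚ.- 1ℚ) ⊗ X)
    ≈⟨ solve 3 (λ x y m → x :+ (y :+ m :* x) := y :+ (m :+ :con 1) :* x) ≋-refl X Y (con (ℚ.- 1ℚ)) ⟩
  Y ⊕ (con (ℚ.- 1ℚ) ⊕ con 1ℚ) ⊗ X
    ≈⟨ ⊕-cong ≋-refl (≋-trans (⊗-cong -1+1 ≋-refl) (⊗-zeroˡ X)) ⟩
  Y ⊕ con 0ℚ
    ≈⟨ P.+-identityʳ Y ⟩
  Y ∎)
  where open ≋-Reasoning

monomial : ℕ → ℕ → Poly XY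
monomial a b = X ^ᴾ a ⊗ Z ^ᴾ b

Y-monomial : ∀ a b → Y ⊗ monomial a b ≋ monomial (suc a) b ⊕ monomial a (suc b)
Y-monomial a b = ≋-trans (⊗-cong Y≋X⊕Z ≋-refl)
  (solve 4 (λ x z p q → (x :+ z) :* (p :* q) := x :* p :* q :+ p :* (z :* q)) ≋-refl X Z (X ^ᴾ a) (Z ^ᴾ b))

leibniz : ∀ p q → ⟦ D ⟧ (p ⊗ q) ≋ ⟦ D ⟧ p ⊗ q ⊕ p ⊗ ⟦ D ⟧ q
leibniz p q = solve 6 (λ p q px qx py qy →
    (px :* q :+ p :* qx) :+ (py :* q :+ p :* qy) := (px :+ py) :* q :+ p :* (qx :+ qy)) ≋-refl
  p q (⟦ ∂x ⟧ p) (⟦ ∂x ⟧ q) (⟦ ∂y ⟧ p) (⟦ ∂y ⟧ q)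

D-X : ⟦ D ⟧ X ≋ con 1ℚ
D-X = P.+-identityʳ _

D-Z : ⟦ D ⟧ Z ≋ con 0ℚ
D-Z = ≋-trans (solve 2 (λ x m → :con 0 :+ (:con 0 :* x :+ m :* :con 1) :+ (:con 1 :+ (:con 0 :* x :+ m :* :con 0)) := m :+ :con 1)
  ≋-refl X (con (ℚ.- 1ℚ))) -1+1

D-Z^ : ∀ b → ⟦ D ⟧ (Z ^ᴾ b) ≋ con 0ℚ
D-Z^ zero    = ⊕-identityˡ _
D-Z^ (suc b) = ≋-trans (leibniz Z (Z ^ᴾ b)) (≋-trans
  (⊕-cong (⊗-cong D-Z ≋-refl) (⊗-cong ≋-refl (D-Z^ b)))
  (solve 2 (λ z w → :con 0 :* w :+ z :* :con 0 := :con 0) ≋-refl Z (Z ^ᴾ b)))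

D-X^ : ∀ a → ⟦ D ⟧ (X ^ᴾ suc a) ≋ con (fromℕ (suc a)) ⊗ X ^ᴾ a
D-X^ zero    = ≋-trans (leibniz X (con 1ℚ)) (≋-trans (⊕-cong (⊗-cong D-X ≋-refl) (⊗-cong ≋-refl (D-Z^ 0)))
  (solve 1 (λ x → :con 1 :* :con 1 :+ x :* :con 0 := :con 1 :* :con 1) ≋-refl X))
D-X^ (suc a) = ≋-trans (leibniz X (X ^ᴾ suc a)) (≋-trans (⊕-cong (⊗-cong D-X ≋-refl) (⊗-cong ≋-refl (D-X^ a)))
  (≋-trans (solve 3 (λ x n w → :con 1 :* (x :* w) :+ x :* (n :* w) := (:con 1 :+ n) :* (x :* w)) ≋-refl
    X (con (fromℕ (suc a))) (X ^ᴾ a))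
  (⊗-cong (≋-trans (≋-sym (con-⊕ 1ℚ _)) (≡⇒≋ (cong con (sym (fromℕ-suc (suc a)))))) ≋-refl)))

D-monomial-zero : ∀ b → ⟦ D ⟧ (monomial 0 b) ≋ con 0ℚ
D-monomial-zero b = ≋-trans (⟦⟧-cong D (⊗-identityˡ (Z ^ᴾ b))) (D-Z^ b)

D-monomial-suc : ∀ a b → ⟦ D ⟧ (monomial (suc a) b) ≋ con (fromℕ (suc a)) ⊗ monomial a b
D-monomial-suc a b = ≋-trans (leibniz (X ^ᴾ suc a) (Z ^ᴾ b)) (≋-trans
  (⊕-cong (⊗-cong (D-X^ a) ≋-refl) (⊗-cong ≋-refl (D-Z^ b)))
  (solve 4 (λ n w z u → n :* w :* z :+ u :* :con 0 := n :* (w :* z)) ≋-refl (con (fromℕ (suc a))) (X ^ᴾ a) (Z ^ᴾ b) (X ^ᴾ suc a)))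

-- A power carries its new factor outermost, while the induction below applies `D` to the monomial
-- first.
D^-suc : ∀ j p → ⟦ D ^ᴱ suc j ⟧ p ≋ ⟦ D ^ᴱ j ⟧ (⟦ D ⟧ p)
D^-suc zero    p = ≋-refl
D^-suc (suc j) p = ⟦⟧-cong D (D^-suc j p)

-- As D kills Z, the operator x^j D^j acts on x^a Z^b as on x^a, with eigenvalue a (a - 1) ⋯ (a - j
-- + 1) = C(a, j) j!.
X^D^-monomial : ∀ j a b → X ^ᴾ j ⊗ ⟦ D ^ᴱ j ⟧ (monomial a b) ≋ con (choose a j ℚ.* fromℕ (j !)) ⊗ monomial a b
X^D^-monomial zero    a       b = ≋-refl
X^D^-monomial (suc j) zero    b = begin
  X ^ᴾ suc j ⊗ ⟦ D ^ᴱ suc j ⟧ (monomial 0 b)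
    ≈⟨ ⊗-cong ≋-refl (≋-trans (D^-suc j _) (≋-trans (⟦⟧-cong (D ^ᴱ j) (D-monomial-zero b)) (0ᴹ-homo (D ^ᴱ j)))) ⟩
  X ^ᴾ suc j ⊗ con 0ℚ
    ≈⟨ ≋-trans (P.zeroʳ _) (≋-sym (⊗-zeroˡ _)) ⟩
  con 0ℚ ⊗ monomial 0 b
    ≈⟨ con-cong (ℚ.*-zeroˡ (fromℕ (suc j !))) ⟨
  con (0ℚ ℚ.* fromℕ (suc j !)) ⊗ monomial 0 b ∎
  where open ≋-Reasoning
X^D^-monomial (suc j) (suc a) b = begin
  X ^ᴾ suc j ⊗ ⟦ D ^ᴱ suc j ⟧ (monomial (suc a) b)
    ≈⟨ ⊗-cong ≋-refl (≋-trans (D^-suc j _) (≋-trans (⟦⟧-cong (D ^ᴱ j) (D-monomial-suc a b)) (*ₗ-homo (D ^ᴱ j) _ _))) ⟩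
  X ^ᴾ suc j ⊗ (con (fromℕ (suc a)) ⊗ ⟦ D ^ᴱ j ⟧ (monomial a b))
    ≈⟨ solve 4 (λ x w n u → x :* w :* (n :* u) := n :* (x :* (w :* u))) ≋-refl
         X (X ^ᴾ j) (con (fromℕ (suc a))) (⟦ D ^ᴱ j ⟧ (monomial a b)) ⟩
  con (fromℕ (suc a)) ⊗ (X ⊗ (X ^ᴾ j ⊗ ⟦ D ^ᴱ j ⟧ (monomial a b)))
    ≈⟨ ⊗-cong ≋-refl (⊗-cong ≋-refl (X^D^-monomial j a b)) ⟩
  con (fromℕ (suc a)) ⊗ (X ⊗ (con (choose a j ℚ.* fromℕ (j !)) ⊗ monomial a b))
    ≈⟨ solve 5 (λ n x m w z → n :* (x :* (m :* (w :* z))) := n :* (m :* (x :* w :* z))) ≋-refl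
         (con (fromℕ (suc a))) X (con (choose a j ℚ.* fromℕ (j !))) (X ^ᴾ a) (Z ^ᴾ b) ⟩
  con (fromℕ (suc a)) ⊗ (con (choose a j ℚ.* fromℕ (j !)) ⊗ monomial (suc a) b)
    ≈⟨ ≋-trans (con-con _ _ _) (con-cong coefficient) ⟩
  con (choose (suc a) (suc j) ℚ.* fromℕ (suc j !)) ⊗ monomial (suc a) b ∎
  where
  open ≋-Reasoning
  coefficient : fromℕ (suc a) ℚ.* (choose a j ℚ.* fromℕ (j !)) ≡ choose (suc a) (suc j) ℚ.* fromℕ (suc j !)
  coefficient = trans (sym (ℚ.*-assoc (fromℕ (suc a)) (choose a j) (fromℕ (j !))))
    (trans (cong (ℚ._* fromℕ (j !)) (trans (sym (choose-absorb a j)) (ℚ.*-comm (fromℕ (suc j)) (choose (suc a) (suc j)))))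
    (trans (ℚ.*-assoc (choose (suc a) (suc j)) (fromℕ (suc j)) (fromℕ (j !)))
      (cong (choose (suc a) (suc j) ℚ.*_) (sym (fromℕ-* (suc j) (j !))))))

∑ᴱ-scalar : ∀ {r} (f : Fin r → LinearMap ℚ[x,y] ℚ[x,y]) (w : Fin r → ℚ) p →
  (∀ i → ⟦ f i ⟧ p ≋ con (w i) ⊗ p) → ⟦ ∑ᴱ f ⟧ p ≋ con (ℚΣ.sum w) ⊗ p
∑ᴱ-scalar {zero}  f w p eq = ≋-sym (⊗-zeroˡ p)
∑ᴱ-scalar {suc r} f w p eq = ≋-trans (⊕-cong (eq zero) (∑ᴱ-scalar (f ∘ suc) (w ∘ suc) p (eq ∘ suc)))
  (≋-trans (≋-sym (P.distribʳ p _ _)) (⊗-cong (≋-sym (con-⊕ (w zero) _)) ≋-refl))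

-- The factor 1/j! cancels the j! in the eigenvalue of x^j D^j, and the remaining sum of C(q, j - 1)
-- C(a, j) over j is a Vandermonde sum.
𝒢-monomial : ∀ q a b → ⟦ 𝒢 (ℤ.+ suc q) ⟧ (monomial a b) ≋ con (choose (q + a) (suc q)) ⊗ (Y ^ᴾ suc q ⊗ monomial a b)
𝒢-monomial q a b = begin
  ⟦ 𝒢 (ℤ.+ suc q) ⟧ (monomial a b)
    ≈⟨ ⊗-cong ≋-refl (∑ᴱ-scalar summand (λ i → choose q (toℕ i) ℚ.* choose a (1 + toℕ i)) (monomial a b) term) ⟩
  Y ^ᴾ suc q ⊗ (con (ℚΣ.sum {suc q} λ i → choose q (toℕ i) ℚ.* choose a (1 + toℕ i)) ⊗ monomial a b)
    ≈⟨ ⊗-swap _ _ _ ⟩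
  con (ℚΣ.sum {suc q} λ i → choose q (toℕ i) ℚ.* choose a (1 + toℕ i)) ⊗ (Y ^ᴾ suc q ⊗ monomial a b)
    -- The shift is t = 1 because j = i + 1 starts at 1.
    ≈⟨ con-cong (trans (vandermonde {suc q} {q} a 1 ℕ.≤-refl) (cong (choose (q + a)) (ℕ.+-comm q 1))) ⟩
  con (choose (q + a) (suc q)) ⊗ (Y ^ᴾ suc q ⊗ monomial a b) ∎
  where
  open ≋-Reasoning
  factor : ℕ → ℚ
  factor i = (ℤ.+ (q C i) ℚ./ (suc i !)) {{suc i ℕ.!≢0}}
  summand : Fin (suc q) → LinearMap ℚ[x,y] ℚ[x,y]
  summand i = scale (factor (toℕ i)) ∘ᴱ multiplyBy (X ^ᴾ suc (toℕ i)) ∘ᴱ D ^ᴱ suc (toℕ i)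
  coefficient : ∀ i → factor i ℚ.* (choose a (suc i) ℚ.* fromℕ (suc i !)) ≡ choose q i ℚ.* choose a (suc i)
  coefficient i = trans (*-swap (factor i) (choose a (suc i)) (fromℕ (suc i !)))
    (trans (cong (choose a (suc i) ℚ.*_) (trans (/-*-fromℕ (q C i) (suc i !) {{suc i ℕ.!≢0}}) (fromℕ-C q i)))
      (ℚ.*-comm (choose a (suc i)) (choose q i)))
  term : ∀ i → ⟦ summand i ⟧ (monomial a b) ≋ con (choose q (toℕ i) ℚ.* choose a (1 + toℕ i)) ⊗ monomial a b
  term i = ≋-trans (⊗-cong ≋-refl (X^D^-monomial (suc (toℕ i)) a b))
    (≋-trans (con-con (factor (toℕ i)) _ _) (con-cong (coefficient (toℕ i))))

-- Families of values and the polynomials they represent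

-- `u n κ` plays the role of the degree n part of a series evaluated at κ + 1 ones.
Family : Set
Family = ℕ → ℕ → ℚ

infixl 7 _⋆_
-- Multiplication of series as seen on values: a Cauchy product in the degree, pointwise in κ.
_⋆_ : Family → Family → Family
(u ⋆ v) n k = conv n λ i j → u i k ℚ.* v j k

⋆-congˡ : ∀ {u u′} v → (∀ n k → u n k ≡ u′ n k) → ∀ n k → (u ⋆ v) n k ≡ (u′ ⋆ v) n k
⋆-congˡ v eq n k = conv-cong n λ i j → cong (ℚ._* v j k) (eq i k)

⋆-comm : ∀ u v n k → (u ⋆ v) n k ≡ (v ⋆ u) n k
⋆-comm u v n k = trans (conv-flip n λ i j → u i k ℚ.* v j k) (conv-cong n λ i j → ℚ.*-comm (u j k) (v i k))

⋆-assoc : ∀ u v w n k → ((u ⋆ v) ⋆ w) n k ≡ (u ⋆ (v ⋆ w)) n k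
⋆-assoc u v w n k = trans
  (conv-cong n λ m l → trans (sym (conv-*ʳ m (w l k) λ i j → u i k ℚ.* v j k))
    (conv-cong m λ i j → ℚ.*-assoc (u i k) (v j k) (w l k)))
  (trans (conv-assoc n λ i j l → u i k ℚ.* (v j k ℚ.* w l k))
    (conv-cong n λ i m → conv-*ˡ m (u i k) λ j l → v j k ℚ.* w l k))

⋆-distribˡ : ∀ u v w n k → (u ⋆ λ n k → v n k ℚ.+ w n k) n k ≡ (u ⋆ v) n k ℚ.+ (u ⋆ w) n k
⋆-distribˡ u v w n k = trans (conv-cong n λ i j → ℚ.*-distribˡ-+ (u i k) (v j k) (w j k))
  (conv-+ n (λ i j → u i k ℚ.* v j k) (λ i j → u i k ℚ.* w j k))

⋆-distribʳ : ∀ u v w n k → ((λ n k → v n k ℚ.+ w n k) ⋆ u) n k ≡ (v ⋆ u) n k ℚ.+ (w ⋆ u) n k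
⋆-distribʳ u v w n k = trans (conv-cong n λ i j → ℚ.*-distribʳ-+ (u j k) (v i k) (w i k))
  (conv-+ n (λ i j → v i k ℚ.* u j k) (λ i j → w i k ℚ.* u j k))

⋆-*ʳ : ∀ a u v n k → (u ⋆ λ n k → a ℚ.* v n k) n k ≡ a ℚ.* (u ⋆ v) n k
⋆-*ʳ a u v n k = trans (conv-cong n λ i j → *-swap (u i k) a (v j k)) (conv-*ˡ n a λ i j → u i k ℚ.* v j k)

⋆-δ : ∀ m n (u v : ℕ → ℚ) l k →
  ((λ i k → δ m i ℚ.* u k) ⋆ (λ j k → δ n j ℚ.* v k)) l k ≡ δ (m + n) l ℚ.* (u k ℚ.* v k)
⋆-δ m n u v l k = trans (conv-cong l λ i j → *-interchange (δ m i) (u k) (δ n j) (v k))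
  (trans (conv-*ʳ l (u k ℚ.* v k) λ i j → δ m i ℚ.* δ n j) (cong (ℚ._* (u k ℚ.* v k)) (conv-δ m n l)))

⋆-scalar : ∀ a v n k → ((λ i _ → δ 0 i ℚ.* a) ⋆ v) n k ≡ a ℚ.* v n k
⋆-scalar a v zero    k = cong (ℚ._* v 0 k) (ℚ.*-identityˡ a)
⋆-scalar a v (suc n) k = trans (cong₂ ℚ._+_ (cong (ℚ._* v (suc n) k) (ℚ.*-identityˡ a))
    (trans (conv-cong n λ i j → trans (cong (ℚ._* v j k) (ℚ.*-zeroˡ a)) (ℚ.*-zeroˡ (v j k))) (conv-zero n)))
  (ℚ.+-identityʳ _)

-- Represents u p means that p is the sum of the u n κ Z^{n+1} (x/y)^{κ+1} over all n and κ.
data Represents : Family → Poly XY → Set where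
  basis   : ∀ a b → Represents (λ n κ → δ (a + b) n ℚ.* choose κ a) (monomial (suc a) b)
  add     : ∀ {u v p q} → Represents u p → Represents v q → Represents (λ n κ → u n κ ℚ.+ v n κ) (p ⊕ q)
  scaled  : ∀ {u p} a → Represents u p → Represents (λ n κ → a ℚ.* u n κ) (con a ⊗ p)
  respect : ∀ {u v p q} → (∀ n κ → u n κ ≡ v n κ) → p ≋ q → Represents u p → Represents v q

-- Forward differences and uniqueness

-- The a-th forward difference at 0, which is the coefficient of C(κ, a) in Newton's expansion of u.
Δ : ℕ → (ℕ → ℚ) → ℚ
Δ zero    u = u 0
Δ (suc a) u = Δ a λ κ → u (suc κ) ℚ.- u κ

Δ-cong : ∀ a {u v : ℕ → ℚ} → (∀ κ → u κ ≡ v κ) → Δ a u ≡ Δ a v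
Δ-cong zero    eq = eq 0
Δ-cong (suc a) eq = Δ-cong a λ κ → cong₂ ℚ._-_ (eq (suc κ)) (eq κ)

Δ-+ : ∀ a u v → Δ a (λ κ → u κ ℚ.+ v κ) ≡ Δ a u ℚ.+ Δ a v
Δ-+ zero    u v = refl
Δ-+ (suc a) u v = trans
  (Δ-cong a λ κ → trans (cong (u (suc κ) ℚ.+ v (suc κ) ℚ.+_) (ℚ.neg-distrib-+ (u κ) (v κ)))
    (+-interchange (u (suc κ)) (v (suc κ)) (ℚ.- u κ) (ℚ.- v κ)))
  (Δ-+ a (λ κ → u (suc κ) ℚ.- u κ) (λ κ → v (suc κ) ℚ.- v κ))

Δ-* : ∀ a c u → Δ a (λ κ → c ℚ.* u κ) ≡ c ℚ.* Δ a u
Δ-* zero    c u = refl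
Δ-* (suc a) c u = trans
  (Δ-cong a λ κ → trans (cong (c ℚ.* u (suc κ) ℚ.+_) (ℚ.neg-distribʳ-* c (u κ)))
    (sym (ℚ.*-distribˡ-+ c (u (suc κ)) (ℚ.- u κ))))
  (Δ-* a c (λ κ → u (suc κ) ℚ.- u κ))

Δ-zero : ∀ a → Δ a (const 0ℚ) ≡ 0ℚ
Δ-zero zero    = refl
Δ-zero (suc a) = Δ-zero a

-- By Pascal's rule, C(κ, a + 1) has first difference C(κ, a).
Δ-choose : ∀ a b → Δ b (λ κ → choose κ a) ≡ δ a b
Δ-choose zero    zero    = refl
Δ-choose zero    (suc b) = Δ-zero b
Δ-choose (suc a) zero    = refl
Δ-choose (suc a) (suc b) = trans
  (Δ-cong b λ κ → trans (ℚ.+-assoc (choose κ a) (choose κ (suc a)) (ℚ.- choose κ (suc a)))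
    (trans (cong (choose κ a ℚ.+_) (ℚ.+-inverseʳ (choose κ (suc a)))) (ℚ.+-identityʳ _)))
  (Δ-choose a b)

-- Once i = a, the conditions i + j = a + b and j = b coincide; otherwise both sides vanish.
δ-+-* : ∀ a b i j → δ (a + b) (i + j) ℚ.* δ a i ≡ δ a i ℚ.* δ b j
δ-+-* zero    b zero    j = ℚ.*-comm (δ b j) 1ℚ
δ-+-* zero    b (suc i) j = trans (ℚ.*-zeroʳ (δ b (suc i + j))) (sym (ℚ.*-zeroˡ (δ b j)))
δ-+-* (suc a) b zero    j = trans (ℚ.*-zeroʳ (δ (suc a + b) j)) (sym (ℚ.*-zeroˡ (δ b j)))
δ-+-* (suc a) b (suc i) j = δ-+-* a b i j

∑-δ : ∀ {a B} (u : ℕ → Poly XY) → a < B → PΣ.sum {B} (λ i → con (δ a (toℕ i)) ⊗ u (toℕ i)) ≋ u a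
∑-δ {zero} {suc B} u a<B = ≋-trans
  (⊕-cong (⊗-identityˡ (u 0)) (≋-trans (PΣ.sum-cong-≋ {B} λ i → ⊗-zeroˡ (u (suc (toℕ i)))) (PΣ.sum-replicate-zero B)))
  (P.+-identityʳ _)
∑-δ {suc a} {suc B} u (s≤s a<B) = ≋-trans (⊕-cong (⊗-zeroˡ (u 0)) (∑-δ (u ∘ suc) a<B)) (⊕-identityˡ _)

-- By Newton's forward difference formula, a family determines the polynomial it represents.
expansion : ℕ → Family → Poly XY
expansion B u = PΣ.sum {B} λ a → PΣ.sum {B} λ b → con (Δ (toℕ a) (u (toℕ a + toℕ b))) ⊗ monomial (suc (toℕ a)) (toℕ b)

expansion-basis : ∀ {a b B} → a < B → b < B →
  expansion B (λ n κ → δ (a + b) n ℚ.* choose κ a) ≋ monomial (suc a) b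
expansion-basis {a} {b} {B} a<B b<B = begin
  expansion B (λ n κ → δ (a + b) n ℚ.* choose κ a)
    ≈⟨ PΣ.sum-cong-≋ {B} (λ i → PΣ.sum-cong-≋ {B} λ j → ≋-trans
         (con-cong (coefficient (toℕ i) (toℕ j)))
         (≋-sym (con-con (δ a (toℕ i)) (δ b (toℕ j)) (monomial (suc (toℕ i)) (toℕ j))))) ⟩
  PΣ.sum {B} (λ i → PΣ.sum {B} λ j → con (δ a (toℕ i)) ⊗ (con (δ b (toℕ j)) ⊗ monomial (suc (toℕ i)) (toℕ j)))
    ≈⟨ PΣ.sum-cong-≋ {B} (λ i → ≋-trans
         (≋-sym (P*Σ.*-distribˡ-sum {B} (con (δ a (toℕ i))) λ j → con (δ b (toℕ j)) ⊗ monomial (suc (toℕ i)) (toℕ j)))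
         (⊗-cong ≋-refl (∑-δ (monomial (suc (toℕ i))) b<B))) ⟩
  PΣ.sum {B} (λ i → con (δ a (toℕ i)) ⊗ monomial (suc (toℕ i)) b)
    ≈⟨ ∑-δ (λ i → monomial (suc i) b) a<B ⟩
  monomial (suc a) b ∎
  where
  open ≋-Reasoning
  coefficient : ∀ i j → Δ i (λ κ → δ (a + b) (i + j) ℚ.* choose κ a) ≡ δ a i ℚ.* δ b j
  coefficient i j = trans (Δ-* i (δ (a + b) (i + j)) (λ κ → choose κ a))
    (trans (cong (δ (a + b) (i + j) ℚ.*_) (Δ-choose a i)) (δ-+-* a b i j))

expansion-+ : ∀ B u v → expansion B (λ n κ → u n κ ℚ.+ v n κ) ≋ expansion B u ⊕ expansion B v
expansion-+ B u v = ≋-trans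
  (PΣ.sum-cong-≋ {B} λ i → ≋-trans
    (PΣ.sum-cong-≋ {B} λ j → ≋-trans
      (⊗-cong (≋-trans (≡⇒≋ (cong con (Δ-+ (toℕ i) (u (toℕ i + toℕ j)) (v (toℕ i + toℕ j))))) (con-⊕ _ _)) ≋-refl)
      (P.distribʳ _ _ _))
    (PΣ.∑-distrib-+ {B} _ _))
  (PΣ.∑-distrib-+ {B} _ _)

expansion-* : ∀ B c u → expansion B (λ n κ → c ℚ.* u n κ) ≋ con c ⊗ expansion B u
expansion-* B c u = ≋-trans
  (PΣ.sum-cong-≋ {B} λ i → ≋-trans
    (PΣ.sum-cong-≋ {B} λ j → ≋-trans
      (con-cong (Δ-* (toℕ i) c (u (toℕ i + toℕ j))))
      (≋-sym (con-con c _ _)))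
    (≋-sym (P*Σ.*-distribˡ-sum {B} (con c) _)))
  (≋-sym (P*Σ.*-distribˡ-sum {B} (con c) _))

expansion-cong : ∀ B {u v : Family} → (∀ n κ → u n κ ≡ v n κ) → expansion B u ≋ expansion B v
expansion-cong B eq = PΣ.sum-cong-≋ {B} λ i → PΣ.sum-cong-≋ {B} λ j →
  con-cong (Δ-cong (toℕ i) (eq (toℕ i + toℕ j)))

-- A derivation involves finitely many monomials, so some bound A suffices. Allowing every larger B
-- lets two derivations be compared at the maximum of their bounds.
represents-expansion : ∀ {u p} → Represents u p → ∃[ A ] (∀ B → A ≤ B → p ≋ expansion B u)
represents-expansion (basis a b) = suc (a + b) , λ B A≤B → ≋-sym
  (expansion-basis (ℕ.≤-trans (s≤s (ℕ.m≤m+n a b)) A≤B) (ℕ.≤-trans (s≤s (ℕ.m≤n+m b a)) A≤B))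
represents-expansion (add {u} {v} r s) with represents-expansion r | represents-expansion s
... | A , e | A′ , e′ = A ⊔ A′ , λ B ≤B → ≋-trans
  (⊕-cong (e B (ℕ.m⊔n≤o⇒m≤o A A′ ≤B)) (e′ B (ℕ.m⊔n≤o⇒n≤o A A′ ≤B))) (≋-sym (expansion-+ B u v))
represents-expansion (scaled {u} a r) with represents-expansion r
... | A , e = A , λ B ≤B → ≋-trans (⊗-cong ≋-refl (e B ≤B)) (≋-sym (expansion-* B a u))
represents-expansion (respect eq eq′ r) with represents-expansion r
... | A , e = A , λ B ≤B → ≋-trans (≋-sym eq′) (≋-trans (e B ≤B) (expansion-cong B eq))

represents-unique : ∀ {u p q} → Represents u p → Represents u q → p ≋ q
represents-unique r s with represents-expansion r | represents-expansion s
... | A , e | A′ , e′ = ≋-trans (e (A ⊔ A′) (ℕ.m≤m⊔n A A′)) (≋-sym (e′ (A ⊔ A′) (ℕ.m≤n⊔m A A′)))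

-- Operators acting on families

-- Since y = x + Z, each factor y splits a monomial into two whose families add up by Pascal's rule.
-- In terms of t = x/y, the sum of C(κ, a) t^{κ+1} is (x/Z)^{a+1}, and replacing κ by r + κ divides
-- by t^r.
represents-Y^ : ∀ r a b → Represents (λ n κ → δ (r + (a + b)) n ℚ.* choose (r + κ) (r + a)) (Y ^ᴾ r ⊗ monomial (suc a) b)
represents-Y^ zero    a b = respect (λ _ _ → refl) (≋-sym (⊗-identityˡ _)) (basis a b)
represents-Y^ (suc r) a b = respect
  (λ n κ → pascal n κ)
  (begin
    Y ^ᴾ r ⊗ monomial (suc a) (suc b) ⊕ Y ^ᴾ r ⊗ monomial (suc (suc a)) b
      ≈⟨ ≋-trans (⊕-comm _ _) (≋-sym (⊗-distribˡ-⊕ _ _ _)) ⟩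
    Y ^ᴾ r ⊗ (monomial (suc (suc a)) b ⊕ monomial (suc a) (suc b))
      ≈⟨ ⊗-cong ≋-refl (Y-monomial (suc a) b) ⟨
    Y ^ᴾ r ⊗ (Y ⊗ monomial (suc a) b)
      ≈⟨ ≋-trans (⊗-swap _ _ _) (≋-sym (⊗-assoc _ _ _)) ⟩
    Y ^ᴾ suc r ⊗ monomial (suc a) b ∎)
  (add (represents-Y^ r a (suc b)) (represents-Y^ r (suc a) b))
  where
  open ≋-Reasoning
  pascal : ∀ n κ → δ (r + (a + suc b)) n ℚ.* choose (r + κ) (r + a) ℚ.+ δ (r + (suc a + b)) n ℚ.* choose (r + κ) (r + suc a)
    ≡ δ (suc r + (a + b)) n ℚ.* choose (suc r + κ) (suc r + a)
  pascal n κ rewrite ℕ.+-suc a b | ℕ.+-suc r (a + b) | ℕ.+-suc r a =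
    sym (ℚ.*-distribˡ-+ (δ (suc (r + (a + b))) n) (choose (r + κ) (r + a)) (choose (r + κ) (suc (r + a))))

-- choose (r + κ) r is the value of h_r at z₁ = ⋯ = z_{κ+1} = 1.
complete : ℕ → Family
complete r n κ = δ r n ℚ.* choose (r + κ) r

-- The operator multiplies values by those of h_{q+1}. By linearity this is a matter of the basis,
-- where `𝒢-monomial` and `represents-Y^` reduce it to `choose-choose`.
𝒢-represents : ∀ q {u p} → Represents u p → Represents (complete (suc q) ⋆ u) (⟦ 𝒢 (ℤ.+ suc q) ⟧ p)
𝒢-represents q (basis a b) = respect
  (λ n κ → sym (trans (⋆-δ (suc q) (a + b) (λ κ → choose (suc q + κ) (suc q)) (λ κ → choose κ a) n κ)
    (trans (cong (δ (suc q + (a + b)) n ℚ.*_) (choose-choose (suc q) κ a))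
      (*-swap (δ (suc q + (a + b)) n) (choose (suc q + a) (suc q)) (choose (suc q + κ) (suc q + a))))))
  (≋-trans (con-cong (cong (λ e → choose e (suc q)) (sym (ℕ.+-suc q a)))) (≋-sym (𝒢-monomial q (suc a) b)))
  (scaled (choose (suc q + a) (suc q)) (represents-Y^ (suc q) a b))
𝒢-represents q (add {u} {v} r s) = respect
  (λ n κ → sym (⋆-distribˡ (complete (suc q)) u v n κ)) (≋-sym (+ᴹ-homo (𝒢 (ℤ.+ suc q)) _ _))
  (add (𝒢-represents q r) (𝒢-represents q s))
𝒢-represents q (scaled {u} a r) = respect
  (λ n κ → sym (⋆-*ʳ a (complete (suc q)) u n κ)) (≋-sym (*ₗ-homo (𝒢 (ℤ.+ suc q)) _ _))
  (scaled a (𝒢-represents q r))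
𝒢-represents q (respect {u} {v} eq eq′ r) = respect
  (λ n κ → conv-cong n λ i j → cong (complete (suc q) i κ ℚ.*_) (eq j κ)) (⟦⟧-cong (𝒢 (ℤ.+ suc q)) eq′)
  (𝒢-represents q r)

values : Series → Family
values f n κ = evaluate (suc κ) n f

values-uniform : ∀ r a n κ → values (uniform r a) n κ ≡ δ r n ℚ.* (a ℚ.* choose (r + κ) r)
values-uniform r a n κ = trans (evaluate-uniform r a n κ)
  (trans (ℚ.*-assoc (δ r n) a _) (δ-subst r n λ n → a ℚ.* choose (n + κ) n))

-- Induction on the expression g: generators are `𝒢-represents`, and products become `⋆` because
-- evaluation is multiplicative.
ρ-represents : ∀ g {u p} → Represents u p → Represents (values (ι g) ⋆ u) (⟦ ρ g ⟧ p)
ρ-represents (con a) {u} r = respect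
  (λ n κ → trans (sym (⋆-scalar a u n κ))
    (⋆-congˡ u (λ n κ → sym (trans (values-uniform 0 a n κ) (cong (δ 0 n ℚ.*_) (ℚ.*-identityʳ a)))) n κ))
  ≋-refl (scaled a r)
ρ-represents (var i) {u} r = respect
  (⋆-congˡ u λ n κ → sym (trans (values-uniform (suc i) 1ℚ n κ) (cong (δ (suc i) n ℚ.*_) (ℚ.*-identityˡ _))))
  ≋-refl (𝒢-represents i r)
ρ-represents (g ⊕ g′) {u} r = respect
  (λ n κ → trans (sym (⋆-distribʳ u (values (ι g)) (values (ι g′)) n κ))
    (⋆-congˡ u (λ n κ → sym (evaluate-+ (suc κ) n (ι g) (ι g′))) n κ))
  ≋-refl (add (ρ-represents g r) (ρ-represents g′ r))
ρ-represents (g ⊗ g′) {u} r = respect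
  (λ n κ → trans (sym (⋆-assoc (values (ι g)) (values (ι g′)) u n κ))
    (⋆-congˡ u (λ n κ → sym (evaluate-· (suc κ) n (ι g) (ι g′))) n κ))
  ≋-refl (ρ-represents g (ρ-represents g′ r))

-- The map Φ

-- With s = 0 and u the coefficients along compositions, this is the sum defining `Φ (suc n)`. The
-- factor x^s records `inside` entries already split off.
subsetSum : ∀ n → (Subset n → ℚ) → ℕ → Poly XY
subsetSum n u s = ∑[ ℚ[x,y] ] (subsets n) λ S → con (mobius u S) ⊗ (X ^ᴾ (s + (∣ S ∣ + 1)) ⊗ Y ^ᴾ (suc n ∸ ∣ S ∣))

-- Möbius inversion puts `uₒ` with sign + into the terms lacking the first element and with sign -
-- into those having it. The latter carry x in place of y, so together they give y - x = Z.
subsetSum-suc : ∀ n u s → subsetSum (suc n) u s ≋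
  subsetSum n (u ∘ (inside ∷_)) (suc s) ⊕ Z ⊗ subsetSum n (u ∘ (outside ∷_)) s
subsetSum-suc n u s = begin
  subsetSum (suc n) u s
    ≈⟨ ∑-subsets ℚ[x,y] n _ ⟩
  ∑[ ℚ[x,y] ] (subsets n) (λ S → con (mobius uₒ S) ⊗ (X ^ᴾ (s + (∣ S ∣ + 1)) ⊗ Y ^ᴾ (suc (suc n) ∸ ∣ S ∣))) ⊕
  ∑[ ℚ[x,y] ] (subsets n) (λ S → con (mobius (λ T → uᵢ T ℚ.- uₒ T) S) ⊗ (X ^ᴾ (s + (suc ∣ S ∣ + 1)) ⊗ Y ^ᴾ (suc n ∸ ∣ S ∣)))
    ≈⟨ ⊕-cong (∑-cong ℚ[x,y] (subsets n) outer) (∑-cong ℚ[x,y] (subsets n) inner) ⟩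
  ∑[ ℚ[x,y] ] (subsets n) (λ S → Y ⊗ term uₒ s S) ⊕
  ∑[ ℚ[x,y] ] (subsets n) (λ S → term uᵢ (suc s) S ⊕ con (ℚ.- 1ℚ) ⊗ X ⊗ term uₒ s S)
    ≈⟨ ⊕-cong (∑-⊗ Y (subsets n) (term uₒ s))
         (≋-trans (∑-+ ℚ[x,y] (subsets n) _ _) (⊕-cong ≋-refl (∑-⊗ (con (ℚ.- 1ℚ) ⊗ X) (subsets n) (term uₒ s)))) ⟩
  Y ⊗ A ⊕ (B ⊕ con (ℚ.- 1ℚ) ⊗ X ⊗ A)
    ≈⟨ solve 4 (λ y m a b → y :* a :+ (b :+ m :* a) := b :+ (y :+ m) :* a) ≋-refl Y (con (ℚ.- 1ℚ) ⊗ X) A B ⟩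
  B ⊕ Z ⊗ A ∎
  where
  open ≋-Reasoning
  uₒ = u ∘ (outside ∷_)
  uᵢ = u ∘ (inside ∷_)
  A = subsetSum n uₒ s
  B = subsetSum n uᵢ (suc s)
  term : (Subset n → ℚ) → ℕ → Subset n → Poly XY
  term u s S = con (mobius u S) ⊗ (X ^ᴾ (s + (∣ S ∣ + 1)) ⊗ Y ^ᴾ (suc n ∸ ∣ S ∣))
  ∑-⊗ : ∀ p {I : Set} (is : List I) w → ∑[ ℚ[x,y] ] is (λ i → p ⊗ w i) ≋ p ⊗ ∑[ ℚ[x,y] ] is w
  ∑-⊗ p []       w = ≋-sym (P.zeroʳ p)
  ∑-⊗ p (i ∷ is) w = ≋-trans (⊕-cong ≋-refl (∑-⊗ p is w)) (≋-sym (⊗-distribˡ-⊕ p _ _))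
  outer : ∀ S → con (mobius uₒ S) ⊗ (X ^ᴾ (s + (∣ S ∣ + 1)) ⊗ Y ^ᴾ (suc (suc n) ∸ ∣ S ∣)) ≋ Y ⊗ term uₒ s S
  outer S = ≋-trans
    -- The bound |S| ≤ n keeps the truncated subtraction exact, so that one factor y comes out.
    (⊗-cong ≋-refl (⊗-cong ≋-refl (≡⇒≋ (cong (Y ^ᴾ_) (ℕ.+-∸-assoc 1 (ℕ.m≤n⇒m≤1+n (Subset.∣p∣≤n S)))))))
    (solve 4 (λ m x y z → m :* (x :* (y :* z)) := y :* (m :* (x :* z))) ≋-refl
      (con (mobius uₒ S)) (X ^ᴾ (s + (∣ S ∣ + 1))) Y (Y ^ᴾ (suc n ∸ ∣ S ∣)))
  difference : ∀ S → mobius (λ T → uᵢ T ℚ.- uₒ T) S ≡ mobius uᵢ S ℚ.+ (ℚ.- 1ℚ) ℚ.* mobius uₒ S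
  difference S = trans (mobius-cong (λ T → cong (uᵢ T ℚ.+_) (sym (ℚR.-1*x≈-x (uₒ T)))) S)
    (trans (mobius-+ uᵢ (λ T → (ℚ.- 1ℚ) ℚ.* uₒ T) S) (cong (mobius uᵢ S ℚ.+_) (mobius-* (ℚ.- 1ℚ) uₒ S)))
  inner : ∀ S → con (mobius (λ T → uᵢ T ℚ.- uₒ T) S) ⊗ (X ^ᴾ (s + (suc ∣ S ∣ + 1)) ⊗ Y ^ᴾ (suc n ∸ ∣ S ∣)) ≋
    term uᵢ (suc s) S ⊕ con (ℚ.- 1ℚ) ⊗ X ⊗ term uₒ s S
  inner S = ≋-trans
    (⊗-cong (≋-trans (≡⇒≋ (cong con (difference S))) (≋-trans (con-⊕ _ _) (⊕-cong ≋-refl (con-⊗ _ _))))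
      (⊗-cong (≡⇒≋ (cong (X ^ᴾ_) (ℕ.+-suc s (∣ S ∣ + 1)))) ≋-refl))
    (solve 6 (λ a m b x p q → (a :+ m :* b) :* (x :* p :* q) := a :* (x :* p :* q) :+ m :* x :* (b :* (p :* q))) ≋-refl
      (con (mobius uᵢ S)) (con (ℚ.- 1ℚ)) (con (mobius uₒ S)) X (X ^ᴾ (s + (∣ S ∣ + 1))) (Y ^ᴾ (suc n ∸ ∣ S ∣)))

-- Unrolled by `subsetSum-suc`, T contributes u T times y x^{s+|T|+1} Z^{b+n-|T|}; the exponent b
-- collects the factors Z. The single y turns C(κ, a) into C(κ + 1, a + 1), matching evaluation at κ
-- + 1 variables.
represents-subsetSum : ∀ n u s b →
  Represents (λ N κ → δ (suc s + b + n) N ℚ.* binomialSum n u (suc s) (suc κ)) (Z ^ᴾ b ⊗ subsetSum n u s)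
represents-subsetSum zero u s b = respect
  (λ N κ → trans (*-swap (u []) (δ (suc (s + b)) N) (choose (suc κ) (suc s)))
    (cong (λ e → δ e N ℚ.* (u [] ℚ.* choose (suc κ) (suc s))) (sym (ℕ.+-identityʳ (suc s + b)))))
  (≋-trans
    (solve 5 (λ u y x w z → u :* (y :* :con 1 :* (x :* w :* z)) := z :* (u :* (x :* w :* (y :* :con 1)) :+ :con 0)) ≋-refl
      (con (u [])) Y X (X ^ᴾ s) (Z ^ᴾ b))
    (⊗-cong ≋-refl (⊕-cong (⊗-cong ≋-refl (⊗-cong (≡⇒≋ (cong (X ^ᴾ_) (ℕ.+-comm 1 s))) ≋-refl)) ≋-refl)))
  (scaled (u []) (represents-Y^ 1 s b))
represents-subsetSum (suc n) u s b = respect coefficient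
  (≋-trans (solve 4 (λ z w p q → w :* p :+ z :* w :* q := w :* (p :+ z :* q)) ≋-refl Z (Z ^ᴾ b)
      (subsetSum n (u ∘ (inside ∷_)) (suc s)) (subsetSum n (u ∘ (outside ∷_)) s))
    (⊗-cong ≋-refl (≋-sym (subsetSum-suc n u s))))
  (add (represents-subsetSum n (u ∘ (inside ∷_)) (suc s) b) (represents-subsetSum n (u ∘ (outside ∷_)) s (suc b)))
  where
  coefficient : ∀ N κ →
    δ (suc (suc s) + b + n) N ℚ.* binomialSum n (u ∘ (inside ∷_)) (suc (suc s)) (suc κ) ℚ.+
    δ (suc s + suc b + n) N ℚ.* binomialSum n (u ∘ (outside ∷_)) (suc s) (suc κ) ≡
    δ (suc s + b + suc n) N ℚ.* binomialSum (suc n) u (suc s) (suc κ)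
  coefficient N κ rewrite ℕ.+-suc s b | ℕ.+-suc (s + b) n = trans
    (sym (ℚ.*-distribˡ-+ (δ (suc (suc (s + b + n))) N) _ _))
    (cong (δ (suc (suc (s + b + n))) N ℚ.*_) (ℚ.+-comm (binomialSum n (u ∘ (inside ∷_)) (suc (suc s)) (suc κ)) _))

values-homogeneous : ∀ {N} (f : QSymElement N) n κ → values (coeff f) n κ ≡ δ N n ℚ.* values (coeff f) N κ
values-homogeneous {N} f n κ with n ℕ.≟ N
... | yes refl = trans (sym (ℚ.*-identityˡ _)) (cong (ℚ._* values (coeff f) n κ) (sym (δ-refl n)))
... | no  n≢N  = trans (evaluate-zero (suc κ) n (coeff f) λ α d → homogeneous f α λ d′ → n≢N (trans (sym d) d′))
  (sym (trans (cong (ℚ._* values (coeff f) N κ) (δ-≢ (n≢N ∘ sym))) (ℚ.*-zeroˡ (values (coeff f) N κ))))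

-- The binomial sum given by `represents-subsetSum` at s = b = 0 is the value of f at κ + 1 ones.
-- Degree 0, where the composition is empty, is treated apart: there Φ₀(1) = x represents the
-- constant 1 in degree 0.
Φ-represents : ∀ N (f : QSymElement N) → Represents (values (coeff f)) (⟦ Φ N ⟧ f)
Φ-represents zero f = respect
  (λ n κ → trans (*-swap (coeff f []) (δ 0 n) 1ℚ)
    (trans (cong (δ 0 n ℚ.*_) (trans (ℚ.*-identityʳ _) (sym (evaluate-0 (suc κ) (quasisymmetric f)))))
    (sym (values-homogeneous f n κ))))
  (≋-sym (P.+-identityʳ _))
  (scaled (coeff f []) (basis 0 0))
Φ-represents (suc N) f = respect
  (λ n κ → trans (cong (δ (suc N) n ℚ.*_) (sym (evaluate-quasisymmetric (suc κ) N (quasisymmetric f))))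
    (sym (values-homogeneous f n κ)))
  (⊗-identityˡ _)
  (represents-subsetSum N (coeff f ∘ runs 1) 0 0)

-- Both sides represent the values of g f, which are the `⋆` product of those of g and f.
Φ-⊙ : ∀ m N (g : Λ⟨ m ⟩) (f : QSymElement N) → ⟦ Φ (N + m) ⟧ (g ⊙ f) ≋ ⟦ ρ (Λ⟨_⟩.element g) ⟧ (⟦ Φ N ⟧ f)
Φ-⊙ m N g f = represents-unique (Φ-represents (N + m) (g ⊙ f))
  (respect (λ n κ → sym (evaluate-· (suc κ) n (ι (Λ⟨_⟩.element g)) (coeff f))) ≋-refl
    (ρ-represents (Λ⟨_⟩.element g) (Φ-represents N f)))

-- Commutation of the operators 𝒢

-- `Represents` reaches only multiples of x, whereas operator identities concern all of ℚ[x,y];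
-- these are checked on the spanning set x^a Z^b.
data Spanned : Poly XY → Set where
  monomials : ∀ a b → Spanned (monomial a b)
  add       : ∀ {p q} → Spanned p → Spanned q → Spanned (p ⊕ q)
  scaled    : ∀ {p} a → Spanned p → Spanned (con a ⊗ p)
  respect   : ∀ {p q} → p ≋ q → Spanned p → Spanned q

^-homo : ∀ p m n → p ^ᴾ m ⊗ p ^ᴾ n ≋ p ^ᴾ (m + n)
^-homo p zero    n = ⊗-identityˡ _
^-homo p (suc m) n = ≋-trans (⊗-assoc _ _ _) (⊗-cong ≋-refl (^-homo p m n))

spanned-⊗ : ∀ {p q} → Spanned p → Spanned q → Spanned (p ⊗ q)
spanned-⊗ (monomials a b) (monomials a′ b′) = respect
  (≋-sym (≋-trans (solve 4 (λ x z x′ z′ → x :* z :* (x′ :* z′) := x :* x′ :* (z :* z′)) ≋-refl _ _ _ _)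
    (⊗-cong (^-homo X a a′) (^-homo Z b b′))))
  (monomials (a + a′) (b + b′))
spanned-⊗ s@(monomials _ _) (add t t′)    = respect (≋-sym (⊗-distribˡ-⊕ _ _ _)) (add (spanned-⊗ s t) (spanned-⊗ s t′))
spanned-⊗ s@(monomials _ _) (scaled a t)  = respect (⊗-swap _ _ _) (scaled a (spanned-⊗ s t))
spanned-⊗ s@(monomials _ _) (respect e t) = respect (⊗-cong ≋-refl e) (spanned-⊗ s t)
spanned-⊗ (add s s′)    t = respect (≋-sym (P.distribʳ _ _ _)) (add (spanned-⊗ s t) (spanned-⊗ s′ t))
spanned-⊗ (scaled a s)  t = respect (≋-sym (⊗-assoc _ _ _)) (scaled a (spanned-⊗ s t))
spanned-⊗ (respect e s) t = respect (⊗-cong e ≋-refl) (spanned-⊗ s t)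

spanned : ∀ p → Spanned p
spanned (con a) = respect (≋-trans (⊗-cong ≋-refl (⊗-identityˡ _)) (P.*-identityʳ _)) (scaled a (monomials 0 0))
spanned (var 𝕩) = respect (≋-trans (P.*-identityʳ _) (P.*-identityʳ X)) (monomials 1 0)
spanned (var 𝕪) = respect (≋-trans (⊕-cong (≋-trans (P.*-identityʳ _) (P.*-identityʳ X))
    (≋-trans (⊗-identityˡ _) (P.*-identityʳ Z))) (≋-sym Y≋X⊕Z))
  (add (monomials 1 0) (monomials 0 1))
spanned (p ⊕ q) = add (spanned p) (spanned q)
spanned (p ⊗ q) = spanned-⊗ (spanned p) (spanned q)

monomials-determine : ∀ (E F : LinearMap ℚ[x,y] ℚ[x,y]) → (∀ a b → ⟦ E ⟧ (monomial a b) ≋ ⟦ F ⟧ (monomial a b)) →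
  ∀ p → ⟦ E ⟧ p ≋ ⟦ F ⟧ p
monomials-determine E F eq p = go (spanned p)
  where
  go : ∀ {p} → Spanned p → ⟦ E ⟧ p ≋ ⟦ F ⟧ p
  go (monomials a b) = eq a b
  go (add s t)       = ≋-trans (+ᴹ-homo E _ _) (≋-trans (⊕-cong (go s) (go t)) (≋-sym (+ᴹ-homo F _ _)))
  go (scaled a s)    = ≋-trans (*ₗ-homo E a _) (≋-trans (⊗-cong ≋-refl (go s)) (≋-sym (*ₗ-homo F a _)))
  go (respect e s)   = ≋-trans (⟦⟧-cong E (≋-sym e)) (≋-trans (go s) (⟦⟧-cong F e))

-- On multiples of x the two composites act on values through `⋆`, which is commutative and
-- associative.
𝒢-comm : ∀ q r p → ⟦ 𝒢 (ℤ.+ suc q) ⟧ (⟦ 𝒢 (ℤ.+ suc r) ⟧ p) ≋ ⟦ 𝒢 (ℤ.+ suc r) ⟧ (⟦ 𝒢 (ℤ.+ suc q) ⟧ p)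
𝒢-comm q r = monomials-determine (𝒢 (ℤ.+ suc q) ∘ᴱ 𝒢 (ℤ.+ suc r)) (𝒢 (ℤ.+ suc r) ∘ᴱ 𝒢 (ℤ.+ suc q)) on-monomial
  where
  -- Without a factor x, the coefficient in `𝒢-monomial` is C(q, q + 1) = 0.
  annihilates : ∀ q b → ⟦ 𝒢 (ℤ.+ suc q) ⟧ (monomial 0 b) ≋ con 0ℚ
  annihilates q b = ≋-trans (𝒢-monomial q 0 b)
    (≋-trans (con-cong (trans (cong (λ e → choose e (suc q)) (ℕ.+-identityʳ q)) (choose-above q 0))) (⊗-zeroˡ _))
  on-monomial : ∀ a b → ⟦ 𝒢 (ℤ.+ suc q) ⟧ (⟦ 𝒢 (ℤ.+ suc r) ⟧ (monomial a b)) ≋ ⟦ 𝒢 (ℤ.+ suc r) ⟧ (⟦ 𝒢 (ℤ.+ suc q) ⟧ (monomial a b))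
  on-monomial zero    b = ≋-trans
    (≋-trans (⟦⟧-cong (𝒢 (ℤ.+ suc q)) (annihilates r b)) (0ᴹ-homo (𝒢 (ℤ.+ suc q))))
    (≋-sym (≋-trans (⟦⟧-cong (𝒢 (ℤ.+ suc r)) (annihilates q b)) (0ᴹ-homo (𝒢 (ℤ.+ suc r)))))
  on-monomial (suc a) b = represents-unique
    (𝒢-represents q (𝒢-represents r (basis a b)))
    (respect swap ≋-refl (𝒢-represents r (𝒢-represents q (basis a b))))
    where
    u = complete (suc q)
    v = complete (suc r)
    w : Family
    w n κ = δ (a + b) n ℚ.* choose κ a
    swap : ∀ n κ → (v ⋆ (u ⋆ w)) n κ ≡ (u ⋆ (v ⋆ w)) n κ
    swap n κ = trans (sym (⋆-assoc v u w n κ)) (trans (⋆-congˡ w (⋆-comm v u) n κ) (⋆-assoc u v w n κ))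

-- Well-definedness of ρ on Λ

ρ-comm : ∀ g h p → ⟦ ρ g ⟧ (⟦ ρ h ⟧ p) ≋ ⟦ ρ h ⟧ (⟦ ρ g ⟧ p)
ρ-comm (con a)  h        p = ≋-sym (*ₗ-homo (ρ h) a p)
ρ-comm (g ⊕ g′) h        p = ≋-trans (⊕-cong (ρ-comm g h p) (ρ-comm g′ h p)) (≋-sym (+ᴹ-homo (ρ h) _ _))
ρ-comm (g ⊗ g′) h        p = ≋-trans (⟦⟧-cong (ρ g) (ρ-comm g′ h p)) (ρ-comm g h _)
ρ-comm (var i)  (con a)  p = *ₗ-homo (ρ (var i)) a p
ρ-comm (var i)  (h ⊕ h′) p = ≋-trans (+ᴹ-homo (ρ (var i)) _ _) (⊕-cong (ρ-comm (var i) h p) (ρ-comm (var i) h′ p))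
ρ-comm (var i)  (h ⊗ h′) p = ≋-trans (ρ-comm (var i) h _) (⟦⟧-cong (ρ h) (ρ-comm (var i) h′ p))
ρ-comm (var i)  (var j)  p = 𝒢-comm i j p

-- Each law generating `≋` holds for operators. Only `⊗-comm` depends on the particular operators
-- assigned to the generators.
ρ-cong : ∀ {g h} → g ≋ h → ∀ p → ⟦ ρ g ⟧ p ≋ ⟦ ρ h ⟧ p
ρ-cong ≋-refl               p = ≋-refl
ρ-cong (≋-sym e)            p = ≋-sym (ρ-cong e p)
ρ-cong (≋-trans e e′)       p = ≋-trans (ρ-cong e p) (ρ-cong e′ p)
ρ-cong (⊕-cong e e′)        p = ⊕-cong (ρ-cong e p) (ρ-cong e′ p)
ρ-cong (⊗-cong {p = g} {q′ = h} e e′) p = ≋-trans (⟦⟧-cong (ρ g) (ρ-cong e′ p)) (ρ-cong e (⟦ ρ h ⟧ p))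
ρ-cong (⊕-assoc _ _ _)      p = ⊕-assoc _ _ _
ρ-cong (⊕-comm _ _)         p = ⊕-comm _ _
ρ-cong (⊕-identityˡ _)      p = ≋-trans (⊕-cong (⊗-zeroˡ _) ≋-refl) (⊕-identityˡ _)
ρ-cong (⊗-assoc _ _ _)      p = ≋-refl
ρ-cong (⊗-comm g h)         p = ρ-comm g h p
ρ-cong (⊗-identityˡ _)      p = ⊗-identityˡ _
ρ-cong (⊗-zeroˡ _)          p = ≋-trans (⊗-zeroˡ _) (≋-sym (⊗-zeroˡ _))
ρ-cong (⊗-distribˡ-⊕ g _ _) p = +ᴹ-homo (ρ g) _ _
ρ-cong (con-⊕ a b)          p = ≋-trans (⊗-cong (con-⊕ a b) ≋-refl) (P.distribʳ _ _ _)
ρ-cong (con-⊗ a b)          p = ≋-sym (con-con a b p)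

ρ-∑ : ∀ {I : Set} (is : List I) (c : I → ℚ) (g : I → Poly ℕ) p →
  ⟦ ρ (∑[ polyModule ℕ ] is λ i → con (c i) ⊗ g i) ⟧ p ≋ ∑[ ℚ[x,y] ] is λ i → con (c i) ⊗ ⟦ ρ (g i) ⟧ p
ρ-∑ []       c g p = ⊗-zeroˡ p
ρ-∑ (i ∷ is) c g p = ⊕-cong ≋-refl (ρ-∑ is c g p)

theorem13 : ((m N : ℕ) (g : Λ⟨ m ⟩) (f : QSymElement N) →
    ⟦ Φ (N + m) ⟧ (g ⊙ f) ≋ ⟦ ρ (Λ⟨_⟩.element g) ⟧ (⟦ Φ N ⟧ f))
    × ((N : ℕ) (ƛ : List ℕ) → IsPartition ƛ → (f : QSymElement N) →
    ⟦ Φ (N + sum ƛ) ⟧ (schur ƛ ⊙ f) ≋ ⟦ 𝒢[ ƛ ] ⟧ (⟦ Φ N ⟧ f))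
    × ((ƛ μ : List ℕ) → IsPartition ƛ → IsPartition μ →
    (c : List ℕ → ℚ) → IsLittlewoodRichardson ƛ μ c → (p : Poly XY) →
    ⟦ 𝒢[ ƛ ] ⟧ (⟦ 𝒢[ μ ] ⟧ p)
    ≋ ∑[ ℚ[x,y] ] (partitions (sum ƛ + sum μ)) (λ ν → con (c ν) ⊗ ⟦ 𝒢[ ν ] ⟧ p))
theorem13 = Φ-⊙
  , (λ N ƛ _ → Φ-⊙ (sum ƛ) N (schur ƛ))
  , λ ƛ μ _ _ c eq p → ≋-trans (ρ-cong eq p) (ρ-∑ (partitions (sum ƛ + sum μ)) c s p)
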